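{- Let $\mathcal Q_k=(K_2)^{\square k}$ be the $k$-dimensional hypercube, with $n=2^k$ vertices. Then $$\mathrm{rw}(\mathcal Q_k)=\Omega\left(2^k\cdot\frac{\log k}{k}\right)=\Omega\left(\frac{n\log\log n}{\log n}\right).$$
   Context: $\mathcal Q_k$ is the graph on $\{0,1\}^k$ in which two vertices are adjacent iff they differ in exactly one coordinate. Asymptotics are as $k\to\infty$. Rank-width: for a graph $G=(V,E)$ and $X\subseteq V$, the cut-rank $\rho_G(X)$ is the $\mathbb F_2$-rank of the $0$-$1$ adjacency matrix with rows indexed by $X$ and columns by $V\setminus X$. A rank-decomposition is a pair $(T,L)$ with $T$ a tree with at least two nodes, all of degree 1 or 3, and $L$ a bijection from $V$ to the leaves of $T$; its width is the maximum over edges $e$ of $T$ of $\rho_G$ of the vertex set corresponding to one side of $T-e$. $\mathrm{rw}(G)$ is the minimum width of a rank-decomposition of $G$. -}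

module Defs where

open import Algebra.Bundles using (CommutativeRing)
open import Data.Bool.Base using (Bool; true; false; not; _∧_; T)
open import Data.Bool.Properties using (xor-∧-commutativeRing; _≟_)
open import Data.Fin.Base using (Fin; zero; suc; inject₁; fromℕ; finToFun)
import Data.Fin.Properties as Fin
open import Data.Fin.Subset
  using (Subset; inside; outside; _∈_; _⊆_; Nonempty; ∣_∣; ∁)
open import Data.Fin.Subset.Properties using (_∈?_; _⊆?_; nonempty?; anySubset?)
open import Data.Integer.Base using (+_)
open import Data.List.Base as List using (List; _++_; filter)
open import Data.List.Extrema.Nat using (max)
open import Data.Nat.Base using (ℕ; zero; suc; _+_; _*_; _^_; _≤_; _≡ᵇ_)
open import Data.Nat.Logarithm using (⌈log₂_⌉)
open import Data.Product.Base using (Σ; ∃-syntax; _×_; proj₁)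
import Data.Rational.Unnormalised.Base as ℚᵘ
open ℚᵘ using (ℚᵘ; 0ℚᵘ)
open import Data.Sum.Base using (_⊎_)
open import Data.Vec.Base as Vec using (tabulate; lookup)
open import Function.Bundles using (_⇔_; _⤖_; module Bijection)
open import Function.Definitions using (Injective)
open import Relation.Binary.Construct.Closure.ReflexiveTransitive using (Star)
open import Relation.Binary.PropositionalEquality
  using (_≡_; refl; sym; cong)
open import Relation.Nullary.Decidable
  using (Dec; does; ¬?; _×-dec_; _→-dec_)
open import Relation.Nullary.Negation using (¬_)

open CommutativeRing xor-∧-commutativeRing using (+-commutativeMonoid)
open import Algebra.Properties.CommutativeMonoid.Sum +-commutativeMonoid
  using () renaming (sum to ⨁)

IsGreatest : (ℕ → Set) → ℕ → Set
IsGreatest P w = P w × (∀ {w′} → P w′ → w′ ≤ w)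

IsLeast : (ℕ → Set) → ℕ → Set
IsLeast P w = P w × (∀ {w′} → P w′ → w ≤ w′)

------------------------------------------------------------------------
-- Rank over 𝔽₂

Matrix : ℕ → ℕ → Set
Matrix m n = Fin m → Fin n → Bool

-- Over 𝔽₂ a linear combination of rows is the sum of a set R of rows.
rowSum : ∀ {m n} → Matrix m n → Subset m → Fin n → Bool
rowSum M R j = ⨁ (λ i → lookup R i ∧ M i j)

Dependent : ∀ {m n} → Matrix m n → (S : Subset m) (Y : Subset n) → Set
Dependent M S Y =
  ∃[ R ] R ⊆ S × Nonempty R × (∀ j → j ∈ Y → rowSum M R j ≡ false)

dependent? : ∀ {m n} (M : Matrix m n) S Y → Dec (Dependent M S Y)
dependent? M S Y = anySubset? λ R →
  (R ⊆? S) ×-dec nonempty? R ×-dec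
  Fin.all? (λ j → (j ∈? Y) →-dec (rowSum M R j ≟ false))

subsets : ∀ n → List (Subset n)
subsets zero    = Vec.[] List.∷ List.[]
subsets (suc n) =
  List.map (outside Vec.∷_) (subsets n) ++ List.map (inside Vec.∷_) (subsets n)

-- The rank of the submatrix of M with rows X and columns Y: the largest
-- size of a linearly independent set of its rows.
rank : ∀ {m n} → Matrix m n → Subset m → Subset n → ℕ
rank {m} M X Y =
  max 0 (List.map ∣_∣ (filter (λ S → (S ⊆? X) ×-dec ¬? (dependent? M S Y))
                              (subsets m)))

------------------------------------------------------------------------
-- Finite simple graphs

record Graph (n : ℕ) : Set where
  field
    adj      : Matrix n n
    adj-sym  : ∀ u v → adj u v ≡ adj v u
    adj-irr  : ∀ v → adj v v ≡ false

  infix 4 _~_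
  _~_ : Fin n → Fin n → Set
  u ~ v = T (adj u v)

  degree : Fin n → ℕ
  degree v = ∣ tabulate (adj v) ∣

  Connected : Set
  Connected = ∀ u v → Star _~_ u v

  record Cycle : Set where
    field
      {length-3} : ℕ
      vertex     : Fin (3 + length-3) → Fin n
      injective  : Injective _≡_ _≡_ vertex
      step       : ∀ i → vertex (inject₁ i) ~ vertex (suc i)
      close      : vertex (fromℕ (2 + length-3)) ~ vertex zero

  IsTree : Set
  IsTree = Connected × ¬ Cycle

  -- Adjacency after deleting the edge ab.
  Without : (a b : Fin n) → Fin n → Fin n → Set
  Without a b u v = u ~ v × ¬ (u ≡ a × v ≡ b) × ¬ (u ≡ b × v ≡ a)

  Leaf : Set
  Leaf = ∃[ v ] degree v ≡ 1

cutRank : ∀ {n} → Graph n → Subset n → ℕ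
cutRank G X = rank (Graph.adj G) X (∁ X)

------------------------------------------------------------------------
-- Rank-width

record RankDecomposition (n : ℕ) : Set where
  field
    {nodes}   : ℕ
    tree      : Graph nodes
    nodes≥2   : 2 ≤ nodes

  open Graph tree public

  field
    isTree    : IsTree
    subcubic  : ∀ t → degree t ≡ 1 ⊎ degree t ≡ 3
    labelling : Fin n ⤖ Leaf

  leafOf : Fin n → Fin nodes
  leafOf v = proj₁ (Bijection.to labelling v)

  -- X is the set of vertices labelling the leaves on a's side of tree − ab.
  IsSide : (a b : Fin nodes) → Subset n → Set
  IsSide a b X = ∀ v → v ∈ X ⇔ Star (Without a b) a (leafOf v)

-- Each tree edge occurs here in both orientations, hence with both of its
-- sides; since cutRank G X = cutRank G (∁ X) this does not affect the maximum.
IsWidth : ∀ {n} → Graph n → RankDecomposition n → ℕ → Set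
IsWidth G D = IsGreatest λ r →
  ∃[ a ] ∃[ b ] ∃[ X ] a ~ b × IsSide a b X × r ≡ cutRank G X
  where open RankDecomposition D

-- A graph with fewer than two vertices has no rank-decomposition, and hence
-- no rank-width.
IsRankWidth : ∀ {n} → Graph n → ℕ → Set
IsRankWidth {n} G = IsLeast λ w → Σ (RankDecomposition n) λ D → IsWidth G D w

------------------------------------------------------------------------
-- Hypercubes

-- The vertices Fin (2 ^ k) stand for the points of {0,1}ᵏ through the
-- bijection finToFun : Fin (2 ^ k) → (Fin k → Fin 2).
differ : ∀ k → Fin (2 ^ k) → Fin (2 ^ k) → Subset k
differ k x y =
  tabulate λ i → not (does (finToFun {2} {k} x i Fin.≟ finToFun {2} {k} y i))

hypercube : ∀ k → Graph (2 ^ k)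
hypercube k = record
  { adj     = λ x y → ∣ differ k x y ∣ ≡ᵇ 1
  ; adj-sym = λ x y → cong (λ D → ∣ D ∣ ≡ᵇ 1) (differ-sym x y)
  ; adj-irr = λ x → cong (_≡ᵇ 1) (differ-self x)
  }
  where
  open import Data.Vec.Properties using (tabulate-cong)
  open import Relation.Nullary.Decidable using (yes; no; dec-true)
  open import Relation.Nullary.Negation using (contradiction)
  open import Relation.Binary.PropositionalEquality using (trans)

  ≟-sym : ∀ (a b : Fin 2) → does (a Fin.≟ b) ≡ does (b Fin.≟ a)
  ≟-sym a b with a Fin.≟ b | b Fin.≟ a
  ... | yes _ | yes _ = refl
  ... | no  _ | no  _ = refl
  ... | yes p | no ¬q = contradiction (sym p) ¬q
  ... | no ¬p | yes q = contradiction (sym q) ¬p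

  differ-sym : ∀ x y → differ k x y ≡ differ k y x
  differ-sym x y = tabulate-cong λ i →
    cong not (≟-sym (finToFun {2} {k} x i) (finToFun {2} {k} y i))

  ∣none∣≡0 : ∀ m → ∣ tabulate {n = m} (λ _ → false) ∣ ≡ 0
  ∣none∣≡0 zero    = refl
  ∣none∣≡0 (suc m) = ∣none∣≡0 m

  differ-self : ∀ x → ∣ differ k x x ∣ ≡ 0
  differ-self x = trans
    (cong ∣_∣ (tabulate-cong λ i →
      cong not (dec-true (finToFun {2} {k} x i Fin.≟ finToFun {2} {k} x i) refl)))
    (∣none∣≡0 k)

------------------------------------------------------------------------
-- Asymptotics

infix 4 _∈Ω_
_∈Ω_ : (ℕ → ℕ) → (ℕ → ℚᵘ) → Set
f ∈Ω g = ∃[ c ] 0ℚᵘ ℚᵘ.< c ×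
  ∃[ k₀ ] (∀ k → k₀ ≤ k → c ℚᵘ.* g k ℚᵘ.≤ + f k ℚᵘ./ 1)

-- Total division; the value at denominator 0 is irrelevant asymptotically.
infixl 7 _÷₀_
_÷₀_ : ℕ → ℕ → ℚᵘ
a ÷₀ zero    = 0ℚᵘ
a ÷₀ b@(suc _) = + a ℚᵘ./ b

-- Logarithms are rounded up to integers.  As log₂ m ≤ ⌈log₂ m⌉ ≤ 2 log₂ m for
-- m ≥ 2, this leaves the Ω-classes below unchanged.

-- 2ᵏ · log k / k
cubeBound : ℕ → ℚᵘ
cubeBound k = (2 ^ k * ⌈log₂ k ⌉) ÷₀ k

-- n · log log n / log n
orderBound : ℕ → ℚᵘ
orderBound n = (n * ⌈log₂ ⌈log₂ n ⌉ ⌉) ÷₀ ⌈log₂ n ⌉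

{-# OPTIONS --safe #-}

-- Every rank-decomposition has a tree edge both of whose sides X contain a constant
-- fraction of the cube.  For a direction i and a side xᵢ = b of the cube, the edges
-- in direction i leaving X from that side form an induced matching, so the cut-rank
-- of X is at least half of each influence of X.  By the Kahn-Kalai-Linial theorem
-- some influence of a balanced X is Ω(2ᵏ log k / k).
--
-- To stay within the integers, the Fourier expansion enters only through the
-- quadratic forms Σ_S w(|S|) f̂(S)², which satisfy a two-term recursion over the
-- dimension, and hypercontractivity is used at the noise rate 1/3, where the noise
-- operator is rational.

module Submission where

open import Defs
open import Data.Nat.Base using (ℕ; _^_; _≤_)
open import Data.Product.Base using (_×_)

open import Algebra.Bundles using (CommutativeRing)
import Algebra.Properties.CommutativeMonoid.Sum as Sum
open import Data.Bool.Base using (Bool; true; false; not; _∧_; _xor_; if_then_else_; T)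
open import Data.Bool.Properties using (xor-∧-commutativeRing; not-involutive; not-¬)
  renaming (_≟_ to _≟ᵇ_)
open import Data.Fin.Base
  using (Fin; zero; suc; inject₁; fromℕ; _↑ˡ_; _↑ʳ_; combine; finToFun; funToFin)
open import Data.Fin.Patterns using (0F; 1F)
import Data.Fin.Properties as Fin
open import Data.Fin.Subset
  using (Subset; _∈_; _∉_; _⊆_; _⊂_; ∣_∣; ∁; inside; outside; ⊤; ⁅_⁆; _∩_; _∪_; _-_)
open import Data.Fin.Subset.Properties
open import Data.Integer.Base as ℤ using (ℤ; +_; -[1+_])
import Data.Integer.Properties as ℤ
import Data.Integer.Tactic.RingSolver as ℤ-Solver
import Data.List.Base as List
import Data.List.Extrema as Extrema
open import Data.List.Membership.Propositional using () renaming (_∈_ to _∈ˡ_)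
open import Data.List.Membership.Propositional.Properties
  using (∈-map⁺; ∈-filter⁺; ∈-++⁺ˡ; ∈-++⁺ʳ)
import Data.List.Relation.Unary.All as All
open import Data.List.Relation.Unary.Any using (here)
open import Data.Nat.Base hiding (∣_-_∣)
open import Data.Nat.DivMod using (m≡m%n+[m/n]*n; m%n<n; m/n*n≤m)
open import Data.Nat.Logarithm using (⌈log₂_⌉; ⌈log₂2^n⌉≡n; ⌈log₂⌉-mono-≤)
open import Data.Nat.Properties
open import Data.Nat.Tactic.RingSolver using (solve-∀)
open import Data.Product.Base using (_,_; ∃-syntax; proj₁; proj₂)
import Data.Rational.Unnormalised.Base as ℚᵘ
open import Data.Sum.Base using (_⊎_; inj₁; inj₂; [_,_]′)
open import Data.Vec.Base as Vec
  using (Vec; []; _∷_; insertAt; updateAt; lookup; tabulate; zipWith)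
open import Data.Vec.Properties
  using (tabulate-cong; tabulate∘lookup; lookup∘tabulate; lookup⇒[]=; []=⇒lookup; insertAt-lookup)
open import Effect.Monad using (RawMonad)
open import Function.Base using (_∘_)
open import Function.Bundles using (mk⇔; module Bijection)
open import Function.Definitions using (Injective)
open import Relation.Binary.Construct.Closure.ReflexiveTransitive using (Star; ε; _◅_; _◅◅_)
open import Relation.Binary.PropositionalEquality
open import Relation.Nullary.Decidable
  using (Dec; yes; no; does; dec-true; ¬?; _×-dec_; decidable-stable; ¬¬-excluded-middle)
open import Relation.Nullary.Negation using (¬_; contradiction; ¬¬-Monad)

open Sum +-0-commutativeMonoid
  using (sum; sum-cong-≗) renaming (∑-distrib-+ to sum-distrib-+)
open Sum (CommutativeRing.+-commutativeMonoid xor-∧-commutativeRing)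
  using () renaming (sum to ⨁)

-- Fourier analysis on the cube

-- The Kahn-Kalai-Linial step is a contradiction. If all influences were small, the energy Σ |S|
-- f̂(S)² would be at most D times the variance, with D about (log k)/16. The spectrum would then
-- have low degree on average, and noise would cost the derivatives only a factor of about 3ᴰ, a
-- small power of k. Hypercontractivity says otherwise: a derivative takes the values 0 and ±1 and
-- lives on few points, so its stability is bounded by the power 3/2 of its influence, which gains a
-- larger power of k. The natural rate of the (2,4)-inequality, 1/√3, is irrational. But T_{1/3} is
-- the square of T_{1/√3}, so 𝔼[g · T_{1/3} g] is the squared 2-norm of T_{1/√3} g, and the
-- inequality becomes ‖T_{1/3} g‖₄² ≤ 𝔼[g · T_{1/3} g], with rational operators only. The remaining
-- fractional powers are removed by squaring, and divisions by leaving the Fourier transform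
-- unnormalised.

sq : ℤ → ℕ
sq x = ℤ.∣ x ∣ * ℤ.∣ x ∣

+sq : ∀ x → + sq x ≡ x ℤ.* x
+sq (+ zero)  = refl
+sq (+ suc n) = refl
+sq -[1+ n ]  = refl

parallelogram : ∀ x y → sq (x ℤ.+ y) + sq (x ℤ.- y) ≡ 2 * (sq x + sq y)
parallelogram x y = ℤ.+-injective (begin
  + (sq (x ℤ.+ y) + sq (x ℤ.- y))
    ≡⟨ ℤ.pos-+ (sq (x ℤ.+ y)) _ ⟩
  + sq (x ℤ.+ y) ℤ.+ + sq (x ℤ.- y)
    ≡⟨ cong₂ ℤ._+_ (+sq (x ℤ.+ y)) (+sq (x ℤ.- y)) ⟩
  (x ℤ.+ y) ℤ.* (x ℤ.+ y) ℤ.+ (x ℤ.- y) ℤ.* (x ℤ.- y)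
    ≡⟨ lemma x y ⟩
  + 2 ℤ.* (x ℤ.* x ℤ.+ y ℤ.* y)
    ≡⟨ cong₂ (λ a b → + 2 ℤ.* (a ℤ.+ b)) (+sq x) (+sq y) ⟨
  + 2 ℤ.* (+ sq x ℤ.+ + sq y)
    ≡⟨ cong (+ 2 ℤ.*_) (ℤ.pos-+ (sq x) _) ⟨
  + 2 ℤ.* + (sq x + sq y)
    ≡⟨ ℤ.pos-* 2 (sq x + sq y) ⟨
  + (2 * (sq x + sq y)) ∎)
  where
  open ≡-Reasoning
  lemma : ∀ x y → (x ℤ.+ y) ℤ.* (x ℤ.+ y) ℤ.+ (x ℤ.- y) ℤ.* (x ℤ.- y)
                ≡ + 2 ℤ.* (x ℤ.* x ℤ.+ y ℤ.* y)
  lemma = ℤ-Solver.solve-∀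

4mn≤[m+n]² : ∀ m n → 4 * (m * n) ≤ (m + n) * (m + n)
4mn≤[m+n]² m n with ≤-total m n
... | inj₁ m≤n = subst (λ n → 4 * (m * n) ≤ (m + n) * (m + n)) (m+[n∸m]≡n m≤n) (ordered m (n ∸ m))
  where
  eq : ∀ m d → (m + (m + d)) * (m + (m + d)) ≡ 4 * (m * (m + d)) + d * d
  eq = solve-∀
  ordered : ∀ m d → 4 * (m * (m + d)) ≤ (m + (m + d)) * (m + (m + d))
  ordered m d = subst (4 * (m * (m + d)) ≤_) (sym (eq m d)) (m≤m+n _ _)
... | inj₂ n≤m = subst (λ m → 4 * (m * n) ≤ (m + n) * (m + n)) (m+[n∸m]≡n n≤m) (ordered n (m ∸ n))
  where
  eq : ∀ m d → ((m + d) + m) * ((m + d) + m) ≡ 4 * ((m + d) * m) + d * d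
  eq = solve-∀
  ordered : ∀ m d → 4 * ((m + d) * m) ≤ ((m + d) + m) * ((m + d) + m)
  ordered m d = subst (4 * ((m + d) * m) ≤_) (sym (eq m d)) (m≤m+n _ _)

+-congˡ : ∀ m {n o} → n ≡ o → m + n ≡ m + o
+-congˡ m = cong (λ n → m + n)

infixl 9 _²
_² : ℕ → ℕ
n ² = n * n

²-mono-≤ : ∀ {m n} → m ≤ n → m ² ≤ n ²
²-mono-≤ m≤n = *-mono-≤ m≤n m≤n

sqrt-mono-≤ : ∀ {m n} → m * m ≤ n * n → m ≤ n
sqrt-mono-≤ m²≤n² = ≮⇒≥ λ n<m → <⇒≱ (*-mono-< n<m n<m) m²≤n²

-- Sums over the cube

Point : ℕ → Set
Point = Vec Bool

∑ : ∀ {k} → (Point k → ℕ) → ℕ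
∑ {zero}  f = f []
∑ {suc k} f = ∑ (f ∘ (false ∷_)) + ∑ (f ∘ (true ∷_))

∑ℤ : ∀ {k} → (Point k → ℤ) → ℤ
∑ℤ {zero}  f = f []
∑ℤ {suc k} f = ∑ℤ (f ∘ (false ∷_)) ℤ.+ ∑ℤ (f ∘ (true ∷_))

∑-mono-≤ : ∀ {k} {f g : Point k → ℕ} → (∀ x → f x ≤ g x) → ∑ f ≤ ∑ g
∑-mono-≤ {zero}  f≤g = f≤g []
∑-mono-≤ {suc k} f≤g =
  +-mono-≤ (∑-mono-≤ (f≤g ∘ (false ∷_))) (∑-mono-≤ (f≤g ∘ (true ∷_)))

∑-cong : ∀ {k} {f g : Point k → ℕ} → f ≗ g → ∑ f ≡ ∑ g
∑-cong {zero}  f≗g = f≗g []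
∑-cong {suc k} f≗g =
  cong₂ _+_ (∑-cong (f≗g ∘ (false ∷_))) (∑-cong (f≗g ∘ (true ∷_)))

∑ℤ-cong : ∀ {k} {f g : Point k → ℤ} → f ≗ g → ∑ℤ f ≡ ∑ℤ g
∑ℤ-cong {zero}  f≗g = f≗g []
∑ℤ-cong {suc k} f≗g =
  cong₂ ℤ._+_ (∑ℤ-cong (f≗g ∘ (false ∷_))) (∑ℤ-cong (f≗g ∘ (true ∷_)))

+-interchange : ∀ a b c d → (a + b) + (c + d) ≡ (a + c) + (b + d)
+-interchange = solve-∀

∑-distrib-+ : ∀ {k} (f g : Point k → ℕ) → ∑ (λ x → f x + g x) ≡ ∑ f + ∑ g
∑-distrib-+ {zero}  f g = refl
∑-distrib-+ {suc k} f g = trans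
  (cong₂ _+_ (∑-distrib-+ (f ∘ (false ∷_)) _) (∑-distrib-+ (f ∘ (true ∷_)) _))
  (+-interchange (∑ (f ∘ (false ∷_))) _ _ _)

∑-distrib-* : ∀ {k} c (f : Point k → ℕ) → ∑ (λ x → c * f x) ≡ c * ∑ f
∑-distrib-* {zero}  c f = refl
∑-distrib-* {suc k} c f = trans
  (cong₂ _+_ (∑-distrib-* c (f ∘ (false ∷_))) (∑-distrib-* c (f ∘ (true ∷_))))
  (sym (*-distribˡ-+ c (∑ (f ∘ (false ∷_))) _))

ℤ-interchange : ∀ a b c d → (a ℤ.+ b) ℤ.+ (c ℤ.+ d) ≡ (a ℤ.+ c) ℤ.+ (b ℤ.+ d)
ℤ-interchange = ℤ-Solver.solve-∀

∑ℤ-distrib-+ : ∀ {k} (f g : Point k → ℤ) → ∑ℤ (λ x → f x ℤ.+ g x) ≡ ∑ℤ f ℤ.+ ∑ℤ g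
∑ℤ-distrib-+ {zero}  f g = refl
∑ℤ-distrib-+ {suc k} f g = trans
  (cong₂ ℤ._+_ (∑ℤ-distrib-+ (f ∘ (false ∷_)) _) (∑ℤ-distrib-+ (f ∘ (true ∷_)) _))
  (ℤ-interchange (∑ℤ (f ∘ (false ∷_))) _ _ _)

∑ℤ-distrib-* : ∀ {k} c (f : Point k → ℤ) → ∑ℤ (λ x → c ℤ.* f x) ≡ c ℤ.* ∑ℤ f
∑ℤ-distrib-* {zero}  c f = refl
∑ℤ-distrib-* {suc k} c f = trans
  (cong₂ ℤ._+_ (∑ℤ-distrib-* c (f ∘ (false ∷_))) (∑ℤ-distrib-* c (f ∘ (true ∷_))))
  (sym (ℤ.*-distribˡ-+ c (∑ℤ (f ∘ (false ∷_))) _))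

∑ℤ-+ : ∀ {k} (f : Point k → ℕ) → ∑ℤ (+_ ∘ f) ≡ + ∑ f
∑ℤ-+ {zero}  f = refl
∑ℤ-+ {suc k} f = cong₂ ℤ._+_ (∑ℤ-+ (f ∘ (false ∷_))) (∑ℤ-+ (f ∘ (true ∷_)))

∣∑ℤ∣≤∑∣∣ : ∀ {k} (f : Point k → ℤ) → ℤ.∣ ∑ℤ f ∣ ≤ ∑ (ℤ.∣_∣ ∘ f)
∣∑ℤ∣≤∑∣∣ {zero}  f = ≤-refl
∣∑ℤ∣≤∑∣∣ {suc k} f = ≤-trans
  (ℤ.∣i+j∣≤∣i∣+∣j∣ (∑ℤ (f ∘ (false ∷_))) _)
  (+-mono-≤ (∣∑ℤ∣≤∑∣∣ (f ∘ (false ∷_))) (∣∑ℤ∣≤∑∣∣ (f ∘ (true ∷_))))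

-- Induction over the dimension: from x² ≤ ab and y² ≤ cd one needs (x + y)² ≤ (a + c)(b + d). The
-- cross term 2xy is at most ad + cb, because 4x²y² ≤ 4(ad)(cb) and AM-GM applies to the squares.
cauchy-schwarz : ∀ {k} (f g : Point k → ℕ) →
  ∑ (λ x → f x * g x) * ∑ (λ x → f x * g x)
    ≤ ∑ (λ x → f x * f x) * ∑ (λ x → g x * g x)
cauchy-schwarz {zero} f g = ≤-reflexive (lemma (f []) (g []))
  where
  lemma : ∀ a b → (a * b) * (a * b) ≡ (a * a) * (b * b)
  lemma = solve-∀
cauchy-schwarz {suc k} f g = add
  (∑ (λ x → f (false ∷ x) * g (false ∷ x))) (∑ (λ x → f (true ∷ x) * g (true ∷ x)))
  (∑ (λ x → f (false ∷ x) ²)) (∑ (λ x → g (false ∷ x) ²)) _ _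
  (cauchy-schwarz (f ∘ (false ∷_)) (g ∘ (false ∷_)))
  (cauchy-schwarz (f ∘ (true ∷_)) (g ∘ (true ∷_)))
  where
  open ≤-Reasoning
  eq₁ : ∀ x y → (2 * (x * y)) * (2 * (x * y)) ≡ 4 * ((x * x) * (y * y))
  eq₁ = solve-∀
  eq₂ : ∀ a b c d → 4 * ((a * b) * (c * d)) ≡ 4 * ((a * d) * (c * b))
  eq₂ = solve-∀
  eq₃ : ∀ x y → (x + y) * (x + y) ≡ x * x + y * y + 2 * (x * y)
  eq₃ = solve-∀
  eq₄ : ∀ a b c d → a * b + c * d + (a * d + c * b) ≡ (a + c) * (b + d)
  eq₄ = solve-∀
  add : ∀ x y a b c d → x * x ≤ a * b → y * y ≤ c * d →
        (x + y) * (x + y) ≤ (a + c) * (b + d)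
  add x y a b c d p q = begin
    (x + y) * (x + y)                    ≡⟨ eq₃ x y ⟩
    x * x + y * y + 2 * (x * y)          ≤⟨ +-mono-≤ (+-mono-≤ p q) (sqrt-mono-≤ cross) ⟩
    a * b + c * d + (a * d + c * b)      ≡⟨ eq₄ a b c d ⟩
    (a + c) * (b + d)                    ∎
    where
    cross : (2 * (x * y)) * (2 * (x * y)) ≤ (a * d + c * b) * (a * d + c * b)
    cross = begin
      (2 * (x * y)) * (2 * (x * y))      ≡⟨ eq₁ x y ⟩
      4 * ((x * x) * (y * y))            ≤⟨ *-monoʳ-≤ 4 (*-mono-≤ p q) ⟩
      4 * ((a * b) * (c * d))            ≡⟨ eq₂ a b c d ⟩
      4 * ((a * d) * (c * b))            ≤⟨ 4mn≤[m+n]² (a * d) (c * b) ⟩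
      (a * d + c * b) * (a * d + c * b)  ∎

-- One step of the Walsh-Hadamard transform: the coefficients f̂(S) with 0 ∉ S are those of
-- `even f`, the ones with 0 ∈ S those of `odd f`.
even odd : ∀ {k} → (Point (suc k) → ℤ) → Point k → ℤ
even f x = f (false ∷ x) ℤ.+ f (true ∷ x)
odd  f x = f (false ∷ x) ℤ.- f (true ∷ x)

-- The quadratic form Σ_S w(|S|) f̂(S)², where f̂(S) = Σ_x (-1)^{Σ_{i∈S} x_i} f(x).
spectral : ∀ {k} → (ℕ → ℕ) → (Point k → ℤ) → ℕ
spectral {zero}  w f = w 0 * sq (f [])
spectral {suc k} w f = spectral w (even f) + spectral (w ∘ suc) (odd f)

spectral-cong : ∀ {k} w {f g : Point k → ℤ} → f ≗ g → spectral w f ≡ spectral w g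
spectral-cong {zero}  w f≗g = cong (λ y → w 0 * sq y) (f≗g [])
spectral-cong {suc k} w f≗g = cong₂ _+_
  (spectral-cong w λ x → cong₂ ℤ._+_ (f≗g (false ∷ x)) (f≗g (true ∷ x)))
  (spectral-cong (w ∘ suc) λ x → cong₂ ℤ._-_ (f≗g (false ∷ x)) (f≗g (true ∷ x)))

spectral-mono-≤ : ∀ {k v w} (f : Point k → ℤ) →
                  (∀ d → d ≤ k → v d ≤ w d) → spectral v f ≤ spectral w f
spectral-mono-≤ {zero}  f v≤w = *-monoˡ-≤ (sq (f [])) (v≤w 0 z≤n)
spectral-mono-≤ {suc k} f v≤w = +-mono-≤
  (spectral-mono-≤ (even f) λ d d≤k → v≤w d (m≤n⇒m≤1+n d≤k))
  (spectral-mono-≤ (odd f) λ d d≤k → v≤w (suc d) (s≤s d≤k))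

spectral-congˡ : ∀ {k v w} (f : Point k → ℤ) →
                 (∀ d → d ≤ k → v d ≡ w d) → spectral v f ≡ spectral w f
spectral-congˡ f v≡w = ≤-antisym
  (spectral-mono-≤ f λ d d≤k → ≤-reflexive (v≡w d d≤k))
  (spectral-mono-≤ f λ d d≤k → ≤-reflexive (sym (v≡w d d≤k)))

spectral-+ : ∀ {k} v w (f : Point k → ℤ) →
             spectral (λ d → v d + w d) f ≡ spectral v f + spectral w f
spectral-+ {zero}  v w f = *-distribʳ-+ (sq (f [])) (v 0) (w 0)
spectral-+ {suc k} v w f = trans
  (cong₂ _+_ (spectral-+ v w (even f)) (spectral-+ (v ∘ suc) (w ∘ suc) (odd f)))
  (+-interchange (spectral v (even f)) _ _ _)

spectral-* : ∀ {k} c w (f : Point k → ℤ) →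
             spectral (λ d → c * w d) f ≡ c * spectral w f
spectral-* {zero}  c w f = *-assoc c (w 0) _
spectral-* {suc k} c w f = trans
  (cong₂ _+_ (spectral-* c w (even f)) (spectral-* c (w ∘ suc) (odd f)))
  (sym (*-distribˡ-+ c (spectral w (even f)) _))

parseval : ∀ {k} (f : Point k → ℤ) → spectral (λ _ → 1) f ≡ 2 ^ k * ∑ (sq ∘ f)
parseval {zero}  f = refl
parseval {suc k} f = begin
  spectral (λ _ → 1) (even f) + spectral (λ _ → 1) (odd f)
    ≡⟨ cong₂ _+_ (parseval (even f)) (parseval (odd f)) ⟩
  2 ^ k * ∑ (sq ∘ even f) + 2 ^ k * ∑ (sq ∘ odd f)
    ≡⟨ *-distribˡ-+ (2 ^ k) (∑ (sq ∘ even f)) _ ⟨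
  2 ^ k * (∑ (sq ∘ even f) + ∑ (sq ∘ odd f))
    ≡⟨ cong (2 ^ k *_) (∑-distrib-+ (sq ∘ even f) _) ⟨
  2 ^ k * ∑ (λ x → sq (even f x) + sq (odd f x))
    ≡⟨ cong (2 ^ k *_) (∑-cong λ x → parallelogram (f (false ∷ x)) (f (true ∷ x))) ⟩
  2 ^ k * ∑ (λ x → 2 * (sq (f (false ∷ x)) + sq (f (true ∷ x))))
    ≡⟨ cong (2 ^ k *_) (∑-distrib-* {k} 2 _) ⟩
  2 ^ k * (2 * ∑ (λ x → sq (f (false ∷ x)) + sq (f (true ∷ x))))
    ≡⟨ cong (λ s → 2 ^ k * (2 * s)) (∑-distrib-+ {k} _ _) ⟩
  2 ^ k * (2 * ∑ (sq ∘ f))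
    ≡⟨ lemma (2 ^ k) _ ⟩
  2 ^ suc k * ∑ (sq ∘ f) ∎
  where
  open ≡-Reasoning
  lemma : ∀ p s → p * (2 * s) ≡ (2 * p) * s
  lemma = solve-∀

level₀ level₊ : ℕ → ℕ
level₀ zero    = 1
level₀ (suc _) = 0
level₊ zero    = 0
level₊ (suc _) = 1

spectral-level₀ : ∀ {k} (f : Point k → ℤ) → spectral level₀ f ≡ sq (∑ℤ f)
spectral-level₀ {zero}  f = +-identityʳ _
spectral-level₀ {suc k} f = begin
  spectral level₀ (even f) + spectral (λ _ → 0) (odd f)
    ≡⟨ cong₂ _+_ (spectral-level₀ (even f)) (spectral-* 0 (λ _ → 0) (odd f)) ⟩
  sq (∑ℤ (even f)) + 0
    ≡⟨ +-identityʳ _ ⟩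
  sq (∑ℤ (even f))
    ≡⟨ cong sq (∑ℤ-distrib-+ (f ∘ (false ∷_)) _) ⟩
  sq (∑ℤ f) ∎
  where open ≡-Reasoning

-- Without normalisation `spectral level₊ f` is 4ᵏ times the variance of f. The square of the mean
-- stands on the left to avoid a subtraction in ℕ.
variance : ∀ {k} (f : Point k → ℤ) →
           spectral level₊ f + sq (∑ℤ f) ≡ 2 ^ k * ∑ (sq ∘ f)
variance f = begin
  spectral level₊ f + sq (∑ℤ f)              ≡⟨ +-congˡ (spectral level₊ f) (spectral-level₀ f) ⟨
  spectral level₊ f + spectral level₀ f      ≡⟨ spectral-+ level₊ level₀ f ⟨
  spectral (λ d → level₊ d + level₀ d) f     ≡⟨ spectral-congˡ f (λ { zero _ → refl ; (suc d) _ → refl }) ⟩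
  spectral (λ _ → 1) f                       ≡⟨ parseval f ⟩
  _                                          ∎
  where open ≡-Reasoning

-- Taken as a function of the other coordinates, so that each edge in direction i counts once.
∂ : ∀ {k} → Fin (suc k) → (Point (suc k) → ℤ) → Point k → ℤ
∂ i f x = f (insertAt x i false) ℤ.- f (insertAt x i true)

∂-even : ∀ {k} i (f : Point (suc (suc k)) → ℤ) → even (∂ (suc i) f) ≗ ∂ i (even f)
∂-even i f x = lemma (f (false ∷ insertAt x i false)) _ _ _
  where
  lemma : ∀ a b c d → (a ℤ.- b) ℤ.+ (c ℤ.- d) ≡ (a ℤ.+ c) ℤ.- (b ℤ.+ d)
  lemma = ℤ-Solver.solve-∀

∂-odd : ∀ {k} i (f : Point (suc (suc k)) → ℤ) → odd (∂ (suc i) f) ≗ ∂ i (odd f)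
∂-odd i f x = lemma (f (false ∷ insertAt x i false)) _ _ _
  where
  lemma : ∀ a b c d → (a ℤ.- b) ℤ.- (c ℤ.- d) ≡ (a ℤ.- c) ℤ.- (b ℤ.- d)
  lemma = ℤ-Solver.solve-∀

-- ∂ᵢ sends the character of S to a multiple of that of S ∖ {i}, or to 0 if i ∉ S.
spectral-∂ : ∀ {k} w (f : Point (suc k) → ℤ) →
             sum (λ i → spectral w (∂ i f)) ≡ spectral (λ d → d * w (pred d)) f
spectral-∂ {zero}  w f = lemma (w 0) _
  where
  lemma : ∀ a s → a * s + 0 ≡ (a + 0) * s
  lemma = solve-∀
spectral-∂ {suc k} w f = begin
  spectral w (odd f) + sum (λ i → spectral w (∂ (suc i) f))
    ≡⟨ +-congˡ A (sum-cong-≗ λ i → cong₂ _+_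
         (spectral-cong w (∂-even i f)) (spectral-cong (w ∘ suc) (∂-odd i f))) ⟩
  spectral w (odd f) + sum (λ i → spectral w (∂ i (even f)) + spectral (w ∘ suc) (∂ i (odd f)))
    ≡⟨ +-congˡ A (sum-distrib-+ (λ i → spectral w (∂ i (even f))) (λ i → spectral (w ∘ suc) (∂ i (odd f)))) ⟩
  spectral w (odd f) + (sum (λ i → spectral w (∂ i (even f))) + sum (λ i → spectral (w ∘ suc) (∂ i (odd f))))
    ≡⟨ +-congˡ A (cong₂ _+_ (spectral-∂ w (even f)) (spectral-∂ (w ∘ suc) (odd f))) ⟩
  spectral w (odd f) + (spectral (λ d → d * w (pred d)) (even f) + spectral (λ d → d * w (suc (pred d))) (odd f))
    ≡⟨ +-left-comm A P Q ⟩
  spectral (λ d → d * w (pred d)) (even f) + (spectral w (odd f) + spectral (λ d → d * w (suc (pred d))) (odd f))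
    ≡⟨ +-congˡ P (spectral-+ w _ (odd f)) ⟨
  spectral (λ d → d * w (pred d)) (even f) + spectral (λ d → w d + d * w (suc (pred d))) (odd f)
    ≡⟨ +-congˡ P
         (spectral-congˡ (odd f) λ { zero _ → refl ; (suc d) _ → refl }) ⟩
  spectral (λ d → d * w (pred d)) f ∎
  where
  open ≡-Reasoning
  A P Q : ℕ
  A = spectral w (odd f)
  P = spectral (λ d → d * w (pred d)) (even f)
  Q = spectral (λ d → d * w (suc (pred d))) (odd f)
  +-left-comm : ∀ a b c → a + (b + c) ≡ b + (a + c)
  +-left-comm = solve-∀

-- Noise stability and hypercontractivity

-- stability f = 12ᵏ 𝔼[f · T f] for the noise operator T with parameter 1/3.
stability : ∀ {k} → (Point k → ℤ) → ℕ
stability {k} = spectral (λ d → 3 ^ (k ∸ d))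

stability-suc : ∀ {k} (f : Point (suc k) → ℤ) →
                stability f ≡ 3 * stability (even f) + stability (odd f)
stability-suc {k} f = cong (_+ stability (odd f)) (begin
  spectral (λ d → 3 ^ (suc k ∸ d)) (even f)
    ≡⟨ spectral-congˡ (even f) (λ d d≤k → cong (3 ^_) (+-∸-assoc 1 d≤k)) ⟩
  spectral (λ d → 3 * 3 ^ (k ∸ d)) (even f)
    ≡⟨ spectral-* 3 _ (even f) ⟩
  3 * stability (even f) ∎)
  where open ≡-Reasoning

-- 6ᵏ T.
noise : ∀ {k} → (Point k → ℤ) → Point k → ℤ
noise {zero}  f []          = f []
noise {suc k} f (false ∷ x) = + 3 ℤ.* noise (even f) x ℤ.+ noise (odd f) x
noise {suc k} f (true ∷ x)  = + 3 ℤ.* noise (even f) x ℤ.- noise (odd f) x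

∑f·noise : ∀ {k} (f : Point k → ℤ) → ∑ℤ (λ x → f x ℤ.* noise f x) ≡ + stability f
∑f·noise {zero} f = trans (sym (+sq (f []))) (cong +_ (sym (+-identityʳ _)))
∑f·noise {suc k} f = begin
  ∑ℤ (λ x → f (false ∷ x) ℤ.* noise f (false ∷ x)) ℤ.+ ∑ℤ (λ x → f (true ∷ x) ℤ.* noise f (true ∷ x))
    ≡⟨ ∑ℤ-distrib-+ {k} _ _ ⟨
  ∑ℤ (λ x → f (false ∷ x) ℤ.* noise f (false ∷ x) ℤ.+ f (true ∷ x) ℤ.* noise f (true ∷ x))
    ≡⟨ ∑ℤ-cong (λ x → lemma (f (false ∷ x)) (f (true ∷ x)) (noise (even f) x) (noise (odd f) x)) ⟩
  ∑ℤ (λ x → + 3 ℤ.* (even f x ℤ.* noise (even f) x) ℤ.+ odd f x ℤ.* noise (odd f) x)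
    ≡⟨ ∑ℤ-distrib-+ {k} _ _ ⟩
  ∑ℤ (λ x → + 3 ℤ.* (even f x ℤ.* noise (even f) x)) ℤ.+ ∑ℤ (λ x → odd f x ℤ.* noise (odd f) x)
    ≡⟨ cong₂ ℤ._+_ (∑ℤ-distrib-* {k} (+ 3) _) (∑f·noise (odd f)) ⟩
  + 3 ℤ.* ∑ℤ (λ x → even f x ℤ.* noise (even f) x) ℤ.+ + stability (odd f)
    ≡⟨ cong (λ s → + 3 ℤ.* s ℤ.+ + stability (odd f)) (∑f·noise (even f)) ⟩
  + 3 ℤ.* + stability (even f) ℤ.+ + stability (odd f)
    ≡⟨ cong (ℤ._+ + stability (odd f)) (ℤ.pos-* 3 (stability (even f))) ⟨
  + (3 * stability (even f)) ℤ.+ + stability (odd f)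
    ≡⟨ ℤ.pos-+ (3 * stability (even f)) _ ⟨
  + (3 * stability (even f) + stability (odd f))
    ≡⟨ cong +_ (stability-suc f) ⟨
  + stability f ∎
  where
  open ≡-Reasoning
  lemma : ∀ p q u v →
    p ℤ.* (+ 3 ℤ.* u ℤ.+ v) ℤ.+ q ℤ.* (+ 3 ℤ.* u ℤ.- v)
      ≡ + 3 ℤ.* ((p ℤ.+ q) ℤ.* u) ℤ.+ (p ℤ.- q) ℤ.* v
  lemma = ℤ-Solver.solve-∀

-- After expansion the only mixed term on the left is 72abcd. Adding 36(ad - bc)² trades it for
-- 36(a²d² + b²c²), which raises the coefficients of a²d² and b²c² from 18 to 54.
two-point : ∀ a b c d →
  sq (+ 3 ℤ.* a ℤ.+ b) * sq (+ 3 ℤ.* c ℤ.+ d) + sq (+ 3 ℤ.* a ℤ.- b) * sq (+ 3 ℤ.* c ℤ.- d)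
    ≤ 162 * (sq a * sq c) + 54 * (sq a * sq d) + 54 * (sq b * sq c) + 2 * (sq b * sq d)
two-point a b c d = m+n≤o⇒m≤o _ (≤-reflexive (ℤ.+-injective (begin
  + (sq (+ 3 ℤ.* a ℤ.+ b) * sq (+ 3 ℤ.* c ℤ.+ d) + sq (+ 3 ℤ.* a ℤ.- b) * sq (+ 3 ℤ.* c ℤ.- d)
     + 36 * sq (a ℤ.* d ℤ.- b ℤ.* c))
    ≡⟨ cast₁ (+ 3 ℤ.* a ℤ.+ b) (+ 3 ℤ.* c ℤ.+ d) (+ 3 ℤ.* a ℤ.- b) (+ 3 ℤ.* c ℤ.- d) (a ℤ.* d ℤ.- b ℤ.* c) ⟩
  _ ≡⟨ lemma a b c d ⟩
  _ ≡⟨ cast₂ a b c d ⟨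
  + (162 * (sq a * sq c) + 54 * (sq a * sq d) + 54 * (sq b * sq c) + 2 * (sq b * sq d)) ∎)))
  where
  open ≡-Reasoning
  +sq*sq : ∀ x y → + (sq x * sq y) ≡ x ℤ.* x ℤ.* (y ℤ.* y)
  +sq*sq x y = trans (ℤ.pos-* (sq x) _) (cong₂ ℤ._*_ (+sq x) (+sq y))
  +n*sq*sq : ∀ n x y → + (n * (sq x * sq y)) ≡ + n ℤ.* (x ℤ.* x ℤ.* (y ℤ.* y))
  +n*sq*sq n x y = trans (ℤ.pos-* n _) (cong (+ n ℤ.*_) (+sq*sq x y))
  +-hom : ∀ {m n i j} → + m ≡ i → + n ≡ j → + (m + n) ≡ i ℤ.+ j
  +-hom {m} p q = trans (ℤ.pos-+ m _) (cong₂ ℤ._+_ p q)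
  cast₁ : ∀ x y z w v → + (sq x * sq y + sq z * sq w + 36 * sq v)
    ≡ x ℤ.* x ℤ.* (y ℤ.* y) ℤ.+ z ℤ.* z ℤ.* (w ℤ.* w) ℤ.+ + 36 ℤ.* (v ℤ.* v)
  cast₁ x y z w v = +-hom (+-hom (+sq*sq x y) (+sq*sq z w))
    (trans (ℤ.pos-* 36 (sq v)) (cong (+ 36 ℤ.*_) (+sq v)))
  cast₂ : ∀ a b c d →
    + (162 * (sq a * sq c) + 54 * (sq a * sq d) + 54 * (sq b * sq c) + 2 * (sq b * sq d))
    ≡ + 162 ℤ.* (a ℤ.* a ℤ.* (c ℤ.* c)) ℤ.+ + 54 ℤ.* (a ℤ.* a ℤ.* (d ℤ.* d))
      ℤ.+ + 54 ℤ.* (b ℤ.* b ℤ.* (c ℤ.* c)) ℤ.+ + 2 ℤ.* (b ℤ.* b ℤ.* (d ℤ.* d))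
  cast₂ a b c d = +-hom (+-hom (+-hom (+n*sq*sq 162 a c) (+n*sq*sq 54 a d)) (+n*sq*sq 54 b c)) (+n*sq*sq 2 b d)
  lemma : ∀ a b c d →
    (+ 3 ℤ.* a ℤ.+ b) ℤ.* (+ 3 ℤ.* a ℤ.+ b) ℤ.* ((+ 3 ℤ.* c ℤ.+ d) ℤ.* (+ 3 ℤ.* c ℤ.+ d))
      ℤ.+ (+ 3 ℤ.* a ℤ.- b) ℤ.* (+ 3 ℤ.* a ℤ.- b) ℤ.* ((+ 3 ℤ.* c ℤ.- d) ℤ.* (+ 3 ℤ.* c ℤ.- d))
      ℤ.+ + 36 ℤ.* ((a ℤ.* d ℤ.- b ℤ.* c) ℤ.* (a ℤ.* d ℤ.- b ℤ.* c))
    ≡ + 162 ℤ.* (a ℤ.* a ℤ.* (c ℤ.* c)) ℤ.+ + 54 ℤ.* (a ℤ.* a ℤ.* (d ℤ.* d))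
      ℤ.+ + 54 ℤ.* (b ℤ.* b ℤ.* (c ℤ.* c)) ℤ.+ + 2 ℤ.* (b ℤ.* b ℤ.* (d ℤ.* d))
  lemma = ℤ-Solver.solve-∀

-- The case f = g is the (2,4)-hypercontractive inequality; the bilinear form is
-- what makes the induction over the dimension go through.
hypercontractive : ∀ {k} (f g : Point k → ℤ) →
  ∑ (λ x → sq (noise f x) * sq (noise g x)) ≤ 18 ^ k * (stability f * stability g)
hypercontractive {zero} f g = ≤-reflexive (lemma (sq (f [])) (sq (g [])))
  where
  lemma : ∀ a b → a * b ≡ 1 * ((1 * a) * (1 * b))
  lemma = solve-∀
hypercontractive {suc k} f g = begin
  ∑ (λ x → sq (noise f (false ∷ x)) * sq (noise g (false ∷ x)))
    + ∑ (λ x → sq (noise f (true ∷ x)) * sq (noise g (true ∷ x)))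
    ≡⟨ ∑-distrib-+ {k} _ _ ⟨
  ∑ (λ x → sq (noise f (false ∷ x)) * sq (noise g (false ∷ x))
           + sq (noise f (true ∷ x)) * sq (noise g (true ∷ x)))
    ≤⟨ ∑-mono-≤ (λ x → two-point (noise (even f) x) (noise (odd f) x) (noise (even g) x) (noise (odd g) x)) ⟩
  ∑ (λ x → 162 * ee x + 54 * eo x + 54 * oe x + 2 * oo x)
    ≡⟨ ∑-distrib-+ (λ x → 162 * ee x + 54 * eo x + 54 * oe x) (λ x → 2 * oo x) ⟩
  ∑ (λ x → 162 * ee x + 54 * eo x + 54 * oe x) + ∑ (λ x → 2 * oo x)
    ≡⟨ cong (λ s → s + ∑ (λ x → 2 * oo x)) (∑-distrib-+ (λ x → 162 * ee x + 54 * eo x) (λ x → 54 * oe x)) ⟩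
  ∑ (λ x → 162 * ee x + 54 * eo x) + ∑ (λ x → 54 * oe x) + ∑ (λ x → 2 * oo x)
    ≡⟨ cong (λ s → s + ∑ (λ x → 54 * oe x) + ∑ (λ x → 2 * oo x))
         (∑-distrib-+ (λ x → 162 * ee x) (λ x → 54 * eo x)) ⟩
  ∑ (λ x → 162 * ee x) + ∑ (λ x → 54 * eo x) + ∑ (λ x → 54 * oe x) + ∑ (λ x → 2 * oo x)
    ≡⟨ cong₂ _+_ (cong₂ _+_ (cong₂ _+_
         (∑-distrib-* 162 ee) (∑-distrib-* 54 eo)) (∑-distrib-* 54 oe)) (∑-distrib-* 2 oo) ⟩
  162 * ∑ ee + 54 * ∑ eo + 54 * ∑ oe + 2 * ∑ oo
    ≤⟨ +-mono-≤ (+-mono-≤ (+-mono-≤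
         (*-monoʳ-≤ 162 (hypercontractive (even f) (even g)))
         (*-monoʳ-≤ 54 (hypercontractive (even f) (odd g))))
         (*-monoʳ-≤ 54 (hypercontractive (odd f) (even g))))
         (*-monoʳ-≤ 2 (hypercontractive (odd f) (odd g))) ⟩
  162 * (p * (a * c)) + 54 * (p * (a * d)) + 54 * (p * (b * c)) + 2 * (p * (b * d))
    -- The target 18(3a + b)(3c + d) has coefficients 162, 54, 54 and 18; `two-point` matches the
    -- first three and leaves a slack of 16 in the last.
    ≤⟨ m≤m+n _ (16 * (p * (b * d))) ⟩
  162 * (p * (a * c)) + 54 * (p * (a * d)) + 54 * (p * (b * c)) + 2 * (p * (b * d)) + 16 * (p * (b * d))
    ≡⟨ lemma p a b c d ⟩
  (18 * p) * ((3 * a + b) * (3 * c + d))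
    ≡⟨ cong₂ (λ s t → 18 ^ suc k * (s * t)) (stability-suc f) (stability-suc g) ⟨
  18 ^ suc k * (stability f * stability g) ∎
  where
  open ≤-Reasoning
  ee eo oe oo : Point k → ℕ
  ee x = sq (noise (even f) x) * sq (noise (even g) x)
  eo x = sq (noise (even f) x) * sq (noise (odd g) x)
  oe x = sq (noise (odd f) x) * sq (noise (even g) x)
  oo x = sq (noise (odd f) x) * sq (noise (odd g) x)
  p a b c d : ℕ
  p = 18 ^ k
  a = stability (even f)
  b = stability (odd f)
  c = stability (even g)
  d = stability (odd g)
  lemma : ∀ p a b c d →
    162 * (p * (a * c)) + 54 * (p * (a * d)) + 54 * (p * (b * c)) + 2 * (p * (b * d)) + 16 * (p * (b * d))
      ≡ (18 * p) * ((3 * a + b) * (3 * c + d))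
  lemma = solve-∀

-- Hölder's inequality with exponents 4/3 and 4, raised to the fourth power: for g with values 0 and
-- 1 the factor ‖g‖⁴ in the 4/3-norm is (Σ g)³. Since g = g², Cauchy-Schwarz can be applied twice
-- while a factor g stays with the powers of h.
hölder : ∀ {k} (g h : Point k → ℕ) → (∀ x → g x * g x ≡ g x) →
  ∑ (λ x → g x * h x) ² ² ≤ (∑ g ² * ∑ g) * ∑ (λ x → h x ² ²)
hölder g h idem = begin
  ∑ (λ x → g x * h x) ² ²
    ≤⟨ ²-mono-≤ (step h) ⟩
  (∑ g * ∑ (λ x → g x * h x ²)) ²
    ≡⟨ eq₁ (∑ g) _ ⟩
  ∑ g ² * ∑ (λ x → g x * h x ²) ²
    ≤⟨ *-monoʳ-≤ (∑ g ²) (step (λ x → h x ²)) ⟩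
  ∑ g ² * (∑ g * ∑ (λ x → g x * h x ² ²))
    ≡⟨ *-assoc (∑ g ²) _ _ ⟨
  ∑ g ² * ∑ g * ∑ (λ x → g x * h x ² ²)
    ≤⟨ *-monoʳ-≤ (∑ g ² * ∑ g) (∑-mono-≤ λ x →
         ≤-trans (*-monoˡ-≤ _ (g≤1 x)) (≤-reflexive (*-identityˡ _))) ⟩
  ∑ g ² * ∑ g * ∑ (λ x → h x ² ²) ∎
  where
  open ≤-Reasoning
  eq₁ : ∀ a b → (a * b) * (a * b) ≡ a * a * (b * b)
  eq₁ = solve-∀
  g≤1 : ∀ x → g x ≤ 1
  g≤1 x = bound (g x) (idem x)
    where
    bound : ∀ n → n * n ≡ n → n ≤ 1
    bound zero    _  = z≤n
    bound (suc n) eq = ≤-reflexive (*-cancelʳ-≡ _ 1 (suc n) (trans eq (sym (*-identityˡ (suc n)))))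
  step : ∀ h → ∑ (λ x → g x * h x) ² ≤ ∑ g * ∑ (λ x → g x * h x ²)
  step h = begin
    ∑ (λ x → g x * h x) ²
      ≡⟨ cong _² (∑-cong λ x → trans (cong (_* h x) (sym (idem x))) (*-assoc (g x) (g x) (h x))) ⟩
    ∑ (λ x → g x * (g x * h x)) ²
      ≤⟨ cauchy-schwarz g (λ x → g x * h x) ⟩
    ∑ (λ x → g x ²) * ∑ (λ x → (g x * h x) ²)
      ≡⟨ cong₂ _*_ (∑-cong idem) (∑-cong λ x → trans (eq₁ (g x) (h x)) (cong (_* h x ²) (idem x))) ⟩
    ∑ g * ∑ (λ x → g x * h x ²) ∎

-- The dual form of hypercontractivity. Hölder bounds the stability ⟨g, T g⟩ by the 4/3-norm of g
-- times the 4-norm of T g, and the latter is bounded by the root of the stability itself, which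
-- cancels. The result has order e^(3/2), a gain over e when the support is small.
stability-small-support : ∀ {k} (g : Point k → ℤ) → (∀ x → sq (g x) ≡ ℤ.∣ g x ∣) →
  let e = ∑ (ℤ.∣_∣ ∘ g) in stability g ² ≤ 18 ^ k * (e ² * e)
stability-small-support {k} g idem = cancel (stability g) (begin
  stability g ² * stability g ²
    ≡⟨ cong (λ s → s ² ²) (cong ℤ.∣_∣ (∑f·noise g)) ⟨
  ℤ.∣ ∑ℤ (λ x → g x ℤ.* noise g x) ∣ ² ²
    ≤⟨ ²-mono-≤ (²-mono-≤ (∣∑ℤ∣≤∑∣∣ {k} _)) ⟩
  ∑ (λ x → ℤ.∣ g x ℤ.* noise g x ∣) ² ²
    ≡⟨ cong (λ s → s ² ²) (∑-cong λ x → ℤ.∣i*j∣≡∣i∣*∣j∣ (g x) (noise g x)) ⟩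
  ∑ (λ x → ℤ.∣ g x ∣ * ℤ.∣ noise g x ∣) ² ²
    ≤⟨ hölder (ℤ.∣_∣ ∘ g) (ℤ.∣_∣ ∘ noise g) idem ⟩
  e ² * e * ∑ (λ x → sq (noise g x) * sq (noise g x))
    ≤⟨ *-monoʳ-≤ (e ² * e) (hypercontractive g g) ⟩
  e ² * e * (18 ^ k * stability g ²)
    ≡⟨ lemma (e ² * e) (18 ^ k) _ ⟩
  18 ^ k * (e ² * e) * stability g ² ∎)
  where
  open ≤-Reasoning
  e = ∑ (ℤ.∣_∣ ∘ g)
  lemma : ∀ a b c → a * (b * c) ≡ b * a * c
  lemma = solve-∀
  cancel : ∀ s {b} → s ² * s ² ≤ b * s ² → s ² ≤ b
  cancel zero    _ = z≤n
  cancel (suc s) p = *-cancelʳ-≤ _ _ (suc s ²) p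

-- Influences

sum-≤ : ∀ {n b} (t : Fin n → ℕ) → (∀ i → t i ≤ b) → sum t ≤ n * b
sum-≤ {zero}  t t≤b = z≤n
sum-≤ {suc n} t t≤b = +-mono-≤ (t≤b zero) (sum-≤ (t ∘ suc) (t≤b ∘ suc))

-- Each stability is bounded only through its square; this carries such bounds through a sum without
-- a square root of `b`.
sum²-≤ : ∀ {n b} (t : Fin n → ℕ) → (∀ i → t i ² ≤ b) → sum t ² ≤ n ² * b
sum²-≤ {zero}  t t²≤b = z≤n
sum²-≤ {suc n} {b} t t²≤b = begin
  (x + s) ²                          ≡⟨ eq₁ x s ⟩
  x ² + s ² + 2 * (x * s)
    ≤⟨ +-mono-≤ (+-mono-≤ (t²≤b zero) s²≤) (*-monoʳ-≤ 2 (sqrt-mono-≤ {x * s} {n * b} cross)) ⟩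
  b + n ² * b + 2 * (n * b)          ≡⟨ eq₂ n b ⟩
  (suc n) ² * b                      ∎
  where
  open ≤-Reasoning
  x s : ℕ
  x = t zero
  s = sum (t ∘ suc)
  s²≤ : s ² ≤ n ² * b
  s²≤ = sum²-≤ (t ∘ suc) (t²≤b ∘ suc)
  eq₁ : ∀ x s → (x + s) * (x + s) ≡ x * x + s * s + 2 * (x * s)
  eq₁ = solve-∀
  eq₂ : ∀ n b → b + n * n * b + 2 * (n * b) ≡ (1 + n) * (1 + n) * b
  eq₂ = solve-∀
  eq₃ : ∀ x s → (x * s) * (x * s) ≡ (x * x) * (s * s)
  eq₃ = solve-∀
  eq₄ : ∀ n b → b * (n * n * b) ≡ (n * b) * (n * b)
  eq₄ = solve-∀
  cross : (x * s) ² ≤ (n * b) ²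
  cross = begin
    (x * s) ²            ≡⟨ eq₃ x s ⟩
    x ² * s ²            ≤⟨ *-mono-≤ (t²≤b zero) s²≤ ⟩
    b * (n ² * b)        ≡⟨ eq₄ n b ⟩
    (n * b) ²            ∎

^-distribʳ-* : ∀ n a b → (a * b) ^ n ≡ a ^ n * b ^ n
^-distribʳ-* zero    a b = refl
^-distribʳ-* (suc n) a b = trans (cong (a * b *_) (^-distribʳ-* n a b)) (lemma a b (a ^ n) (b ^ n))
  where
  lemma : ∀ a b c d → a * b * (c * d) ≡ a * c * (b * d)
  lemma = solve-∀

n<2^n : ∀ n → n < 2 ^ n
n<2^n zero    = s≤s z≤n
n<2^n (suc n) = begin
  suc (suc n)        ≡⟨ +-comm 1 (suc n) ⟩
  suc n + 1          ≤⟨ +-mono-≤ (n<2^n n) (m^n>0 2 n) ⟩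
  2 ^ n + 2 ^ n      ≡⟨ +-congˡ (2 ^ n) (+-identityʳ (2 ^ n)) ⟨
  2 ^ suc n          ∎
  where open ≤-Reasoning

n<3^n : ∀ n → n < 3 ^ n
n<3^n n = ≤-trans (n<2^n n) (^-monoˡ-≤ n (s≤s (s≤s z≤n)))

-- The tangent line of d ↦ 3^(D-d) at d = D, multiplied by 3ᵏ.
tangent : ∀ m D d → d ≤ suc m →
  3 ^ suc m * (suc D * level₊ d) ≤ 3 ^ D * (d * 3 ^ (m ∸ pred d)) + 3 ^ suc m * d
tangent m D zero    _         = ≤-trans (≤-reflexive (zeros (3 ^ suc m) D)) z≤n
  where
  zeros : ∀ a b → a * ((1 + b) * 0) ≡ 0
  zeros = solve-∀
tangent m D (suc d) (s≤s d≤m) with ≤-total D d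
-- The degree is d + 1 > D here, and the linear term alone suffices.
... | inj₁ D≤d = begin
  3 ^ suc m * (suc D * 1)        ≤⟨ *-monoʳ-≤ (3 ^ suc m) (≤-trans (≤-reflexive (*-identityʳ (suc D))) (s≤s D≤d)) ⟩
  3 ^ suc m * suc d              ≤⟨ m≤n+m _ _ ⟩
  _                              ∎
  where open ≤-Reasoning
... | inj₂ d≤D = begin
  3 ^ suc m * (suc D * 1)              ≡⟨ cong (λ D → 3 ^ suc m * (suc D * 1)) (m∸n+n≡m d≤D) ⟨
  3 ^ suc m * (suc (j + d) * 1)        ≡⟨ eq₁ (3 ^ m) j d ⟩
  -- For degree d + 1 and j = D - d the claim is j ≤ 3^(j - 1) · (d + 1). The factor 3 taken from
  -- `3 ^ suc m` keeps the exponent natural at j = 0.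
  3 ^ m * (3 * j) + 3 ^ suc m * suc d  ≤⟨ +-monoˡ-≤ _ (*-monoʳ-≤ (3 ^ m) (3j≤ j)) ⟩
  3 ^ m * (3 ^ j * suc d) + 3 ^ suc m * suc d
    ≡⟨ cong (_+ 3 ^ suc m * suc d) eq₂ ⟩
  3 ^ D * (suc d * 3 ^ (m ∸ d)) + 3 ^ suc m * suc d ∎
  where
  open ≤-Reasoning
  j = D ∸ d
  eq₁ : ∀ a j d → 3 * a * ((1 + (j + d)) * 1) ≡ a * (3 * j) + 3 * a * (1 + d)
  eq₁ = solve-∀
  3j≤ : ∀ j → 3 * j ≤ 3 ^ j * suc d
  3j≤ zero    = z≤n
  3j≤ (suc j) = ≤-trans (*-monoʳ-≤ 3 (n<3^n j)) (m≤m*n (3 ^ suc j) (suc d))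
  eq₂ : 3 ^ m * (3 ^ j * suc d) ≡ 3 ^ D * (suc d * 3 ^ (m ∸ d))
  eq₂ = begin-equality
    3 ^ m * (3 ^ j * suc d)                ≡⟨ cong (λ m → 3 ^ m * (3 ^ j * suc d)) (m∸n+n≡m d≤m) ⟨
    3 ^ (m ∸ d + d) * (3 ^ j * suc d)      ≡⟨ cong (_* (3 ^ j * suc d)) (^-distribˡ-+-* 3 (m ∸ d) d) ⟩
    3 ^ (m ∸ d) * 3 ^ d * (3 ^ j * suc d)  ≡⟨ eq₃ (3 ^ (m ∸ d)) (3 ^ d) (3 ^ j) (suc d) ⟩
    3 ^ j * 3 ^ d * (suc d * 3 ^ (m ∸ d))  ≡⟨ cong (_* (suc d * 3 ^ (m ∸ d))) (^-distribˡ-+-* 3 j d) ⟨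
    3 ^ (j + d) * (suc d * 3 ^ (m ∸ d))    ≡⟨ cong (λ D → 3 ^ D * (suc d * 3 ^ (m ∸ d))) (m∸n+n≡m d≤D) ⟩
    3 ^ D * (suc d * 3 ^ (m ∸ d))          ∎
    where
    eq₃ : ∀ a b c d → a * b * (c * d) ≡ c * b * (d * a)
    eq₃ = solve-∀

-- A substitute for Jensen's inequality, obtained by summing `tangent` against f̂(S)²: once the
-- energy is at most D times the variance, the derivatives have total stability at least 3^(k - D)
-- times the variance, where k = m + 1.
noise-vs-energy : ∀ {m} D (f : Point (suc m) → ℤ) →
  3 ^ suc m * (suc D * spectral level₊ f)
    ≤ 3 ^ D * sum (λ i → stability (∂ i f)) + 3 ^ suc m * spectral (λ d → d) f
noise-vs-energy {m} D f = begin
  3 ^ suc m * (suc D * spectral level₊ f)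
    ≡⟨ cong (3 ^ suc m *_) (spectral-* (suc D) level₊ f) ⟨
  3 ^ suc m * spectral (λ d → suc D * level₊ d) f
    ≡⟨ spectral-* (3 ^ suc m) (λ d → suc D * level₊ d) f ⟨
  spectral (λ d → 3 ^ suc m * (suc D * level₊ d)) f
    ≤⟨ spectral-mono-≤ f (tangent m D) ⟩
  spectral (λ d → 3 ^ D * w d + 3 ^ suc m * d) f
    ≡⟨ spectral-+ (λ d → 3 ^ D * w d) (λ d → 3 ^ suc m * d) f ⟩
  spectral (λ d → 3 ^ D * w d) f + spectral (λ d → 3 ^ suc m * d) f
    ≡⟨ cong₂ _+_ (spectral-* (3 ^ D) w f) (spectral-* (3 ^ suc m) (λ d → d) f) ⟩
  3 ^ D * spectral w f + 3 ^ suc m * spectral (λ d → d) f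
    ≡⟨ cong (λ s → 3 ^ D * s + 3 ^ suc m * spectral (λ d → d) f) (spectral-∂ (λ d → 3 ^ (m ∸ d)) f) ⟨
  3 ^ D * sum (λ i → stability (∂ i f)) + 3 ^ suc m * spectral (λ d → d) f ∎
  where
  open ≤-Reasoning
  w : ℕ → ℕ
  w d = d * 3 ^ (m ∸ pred d)

𝟙 : Bool → ℕ
𝟙 b = if b then 1 else 0

indicator : ∀ {k} → (Point k → Bool) → Point k → ℤ
indicator X x = + 𝟙 (X x)

-- The number of boundary edges of X in direction i.
influence : ∀ {k} → (Point (suc k) → Bool) → Fin (suc k) → ℕ
influence X i = ∑ (λ x → ℤ.∣ ∂ i (indicator X) x ∣)

sq-∂ : ∀ {k} (X : Point (suc k) → Bool) i x →
       sq (∂ i (indicator X) x) ≡ ℤ.∣ ∂ i (indicator X) x ∣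
sq-∂ X i x = lemma (X (insertAt x i false)) (X (insertAt x i true))
  where
  lemma : ∀ a b → sq (+ 𝟙 a ℤ.- + 𝟙 b) ≡ ℤ.∣ + 𝟙 a ℤ.- + 𝟙 b ∣
  lemma false false = refl
  lemma false true  = refl
  lemma true  false = refl
  lemma true  true  = refl

-- The energy is exactly 2ᵐ times the total influence, by `spectral-∂` with weight 1 and Parseval
-- for each derivative.
energy-≤ : ∀ {m b} (X : Point (suc m) → Bool) → (∀ i → influence X i ≤ b) →
           spectral (λ d → d) (indicator X) ≤ 2 ^ m * (suc m * b)
energy-≤ {m} {b} X influence≤b = begin
  spectral (λ d → d) f                ≡⟨ spectral-congˡ f (λ d _ → sym (*-identityʳ d)) ⟩
  spectral (λ d → d * 1) f            ≡⟨ spectral-∂ (λ _ → 1) f ⟨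
  sum (λ i → spectral (λ _ → 1) (∂ i f))
    ≤⟨ sum-≤ _ (λ i → ≤-trans
         (≤-reflexive (trans (parseval (∂ i f)) (cong (2 ^ m *_) (∑-cong (sq-∂ X i)))))
         (*-monoʳ-≤ (2 ^ m) (influence≤b i))) ⟩
  suc m * (2 ^ m * b)                 ≡⟨ lemma (suc m) (2 ^ m) b ⟩
  2 ^ m * (suc m * b)                 ∎
  where
  open ≤-Reasoning
  f = indicator X
  lemma : ∀ a b c → a * (b * c) ≡ b * (a * c)
  lemma = solve-∀

noise-≤ : ∀ {m b} (X : Point (suc m) → Bool) → (∀ i → influence X i ≤ b) →
          sum (λ i → stability (∂ i (indicator X))) ² ≤ suc m ² * (18 ^ m * (b ² * b))
noise-≤ {m} X influence≤b = sum²-≤ (λ i → stability (∂ i (indicator X))) λ i →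
  ≤-trans (stability-small-support (∂ i (indicator X)) (sq-∂ X i))
    (*-monoʳ-≤ (18 ^ m) (*-mono-≤ (²-mono-≤ (influence≤b i)) (influence≤b i)))

-- For an indicator, 4ᵏ times the variance is the product of the sizes of X and its complement, both
-- at least t. For the complement, 1 ≤ t absorbs the +1 in the upper bound on X.
variance-≥ : ∀ {k t} (X : Point k → Bool) → 2 ^ k ≡ 4 * t → 1 ≤ t →
  t < ∑ (𝟙 ∘ X) → ∑ (𝟙 ∘ X) ≤ 2 * t + 1 → t ² ≤ spectral level₊ (indicator X)
variance-≥ {k} {t} X n≡4t 1≤t t<s s≤2t+1 = +-cancelʳ-≤ (s ²) _ _ (begin
  t ² + s ²                                     ≤⟨ +-monoˡ-≤ (s ²) (*-mono-≤ (<⇒≤ t<s) t≤u) ⟩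
  s * u + s ²                                   ≡⟨ eq s u ⟩
  (u + s) * s                                   ≡⟨ cong (_* s) u+s≡n ⟩
  2 ^ k * s                                     ≡⟨ cong (2 ^ k *_) (∑-cong λ x → idem (X x)) ⟨
  2 ^ k * ∑ (sq ∘ indicator X)                  ≡⟨ variance (indicator X) ⟨
  spectral level₊ (indicator X) + sq (∑ℤ (indicator X))
    ≡⟨ cong (λ i → spectral level₊ (indicator X) + sq i) (∑ℤ-+ (𝟙 ∘ X)) ⟩
  spectral level₊ (indicator X) + s ²           ∎)
  where
  open ≤-Reasoning
  s = ∑ (𝟙 ∘ X)
  u = 2 ^ k ∸ s
  idem : ∀ b → sq (+ 𝟙 b) ≡ 𝟙 b
  idem false = refl
  idem true  = refl
  eq : ∀ s u → s * u + s * s ≡ (u + s) * s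
  eq = solve-∀
  eq₂ : ∀ t → t + (2 * t + t) ≡ 4 * t
  eq₂ = solve-∀
  t+s≤n : t + s ≤ 2 ^ k
  t+s≤n = begin
    t + s              ≤⟨ +-monoʳ-≤ t (≤-trans s≤2t+1 (+-monoʳ-≤ (2 * t) 1≤t)) ⟩
    t + (2 * t + t)    ≡⟨ eq₂ t ⟩
    4 * t              ≡⟨ n≡4t ⟨
    2 ^ k              ∎
  u+s≡n : u + s ≡ 2 ^ k
  u+s≡n = m∸n+n≡m (≤-trans (m≤n+m s t) t+s≤n)
  t≤u : t ≤ u
  t≤u = m+n≤o⇒m≤o∸n t t+s≤n

-- Arithmetic of the Kahn-Kalai-Linial argument

2^⌈log₂n⌉≤2n : ∀ k → 1 ≤ k → 2 ^ ⌈log₂ k ⌉ ≤ 2 * k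
2^⌈log₂n⌉≤2n k 1≤k with ⌈log₂ k ⌉ in eq
... | zero  = *-mono-≤ {1} {2} (s≤s z≤n) 1≤k
... | suc l = *-monoʳ-≤ 2 {2 ^ l} {k} (≮⇒≥ λ k<2^l →
  1+n≰n (≤-trans (≤-reflexive (sym eq)) (≤-trans (⌈log₂⌉-mono-≤ (<⇒≤ k<2^l)) (≤-reflexive (⌈log₂2^n⌉≡n l)))))

-- From 9ᴰ ≤ 2^(4D) and L ≤ 16D ≤ 2^(4 + D) the left side is at most 2^(12 + 7D). As D is about
-- L/16, this is of order k^(7/16); the constant is paid for by 2^(2e).
poly-log : ∀ e k D → 10 ≤ e → 1 ≤ k → 1 ≤ D →
  ⌈log₂ k ⌉ ≤ 16 * D → 16 * D ≤ ⌈log₂ k ⌉ + 16 →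
  9 ^ D * (⌈log₂ k ⌉ * ⌈log₂ k ⌉ * ⌈log₂ k ⌉) < 9 * (2 ^ e * 2 ^ e) * k
poly-log e k D 10≤e 1≤k 1≤D L≤16D 16D≤L+16 = *-cancelˡ-< 2 _ _ (begin-strict
  2 * (9 ^ D * (L * L * L))
    ≤⟨ *-monoʳ-≤ 2 (*-mono-≤ 9^D≤ (*-mono-≤ (*-mono-≤ L≤ L≤) L≤)) ⟩
  2 * (2 ^ (4 * D) * (2 ^ (4 + D) * 2 ^ (4 + D) * 2 ^ (4 + D)))
    ≡⟨ powers ⟩
  2 ^ (13 + 7 * D)
    ≤⟨ ^-monoʳ-≤ 2 exponents ⟩
  2 ^ ((e + e) + L)
    ≡⟨ ^-distribˡ-+-* 2 (e + e) L ⟩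
  2 ^ (e + e) * 2 ^ L
    ≤⟨ *-monoʳ-≤ (2 ^ (e + e)) (2^⌈log₂n⌉≤2n k 1≤k) ⟩
  2 ^ (e + e) * (2 * k)
    <⟨ m<m+n _ {16 * (2 ^ (e + e) * k)} (>-nonZero⁻¹ _
         {{m*n≢0 16 _ {{_}} {{m*n≢0 _ k {{m^n≢0 2 (e + e)}} {{>-nonZero 1≤k}}}}}}) ⟩
  2 ^ (e + e) * (2 * k) + 16 * (2 ^ (e + e) * k)
    ≡⟨ eq (2 ^ (e + e)) k ⟩
  2 * (9 * 2 ^ (e + e) * k)
    ≡⟨ cong (λ c → 2 * (9 * c * k)) (^-distribˡ-+-* 2 e e) ⟩
  2 * (9 * (2 ^ e * 2 ^ e) * k) ∎)
  where
  open ≤-Reasoning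
  L = ⌈log₂ k ⌉
  9^D≤ : 9 ^ D ≤ 2 ^ (4 * D)
  9^D≤ = ≤-trans (^-monoˡ-≤ D (m≤m+n 9 7)) (≤-reflexive (^-*-assoc 2 4 D))
  L≤ : L ≤ 2 ^ (4 + D)
  L≤ = begin
    L               ≤⟨ L≤16D ⟩
    16 * D          ≤⟨ *-monoʳ-≤ 16 (<⇒≤ (n<2^n D)) ⟩
    16 * 2 ^ D      ≡⟨ ^-distribˡ-+-* 2 4 D ⟨
    2 ^ (4 + D)     ∎
  eq : ∀ a k → a * (2 * k) + 16 * (a * k) ≡ 2 * (9 * a * k)
  eq = solve-∀
  exponents : 13 + 7 * D ≤ (e + e) + L
  exponents = +-cancelʳ-≤ 16 _ _ (begin
    13 + 7 * D + 16                     ≡⟨ eq₁ D ⟩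
    20 + (9 * 1 + 7 * D)                ≤⟨ +-monoʳ-≤ 20 (+-monoˡ-≤ (7 * D) (*-monoʳ-≤ 9 1≤D)) ⟩
    20 + (9 * D + 7 * D)                ≡⟨ eq₂ D ⟩
    20 + 16 * D                         ≤⟨ +-mono-≤ (+-mono-≤ 10≤e 10≤e) 16D≤L+16 ⟩
    (e + e) + (L + 16)                  ≡⟨ +-assoc (e + e) L 16 ⟨
    (e + e) + L + 16                    ∎)
    where
    eq₁ : ∀ D → 13 + 7 * D + 16 ≡ 20 + (9 * 1 + 7 * D)
    eq₁ = solve-∀
    eq₂ : ∀ D → 20 + (9 * D + 7 * D) ≡ 20 + 16 * D
    eq₂ = solve-∀
  powers : 2 * (2 ^ (4 * D) * (2 ^ (4 + D) * 2 ^ (4 + D) * 2 ^ (4 + D))) ≡ 2 ^ (13 + 7 * D)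
  powers = begin-equality
    2 * (2 ^ (4 * D) * (2 ^ (4 + D) * 2 ^ (4 + D) * 2 ^ (4 + D)))
      ≡⟨ cong (λ s → 2 * (2 ^ (4 * D) * (s * 2 ^ (4 + D)))) (^-distribˡ-+-* 2 (4 + D) (4 + D)) ⟨
    2 * (2 ^ (4 * D) * (2 ^ ((4 + D) + (4 + D)) * 2 ^ (4 + D)))
      ≡⟨ cong (λ s → 2 * (2 ^ (4 * D) * s)) (^-distribˡ-+-* 2 ((4 + D) + (4 + D)) (4 + D)) ⟨
    2 * (2 ^ (4 * D) * 2 ^ ((4 + D) + (4 + D) + (4 + D)))
      ≡⟨ cong (2 *_) (^-distribˡ-+-* 2 (4 * D) ((4 + D) + (4 + D) + (4 + D))) ⟨
    2 ^ (1 + (4 * D + ((4 + D) + (4 + D) + (4 + D))))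
      ≡⟨ cong (2 ^_) (eq₁ D) ⟩
    2 ^ (13 + 7 * D) ∎
    where
    eq₁ : ∀ D → 1 + (4 * D + ((4 + D) + (4 + D) + (4 + D))) ≡ 13 + 7 * D
    eq₁ = solve-∀

-- V, E and P stand for variance, energy and total stability of the derivatives, and
-- `c * (k * w) ≤ n * L` is the assumption to be refuted. It makes the energy at most V · D, so V is
-- bounded by P alone. The bound on P is cubic in w after squaring and contributes k² where the
-- assumption contributes k⁻³, so one factor k survives on the left of the conclusion, contradicting
-- `poly-log`.
kkl-arithmetic : ∀ {c m n p w L D V E P} (let k = suc m) → 1024 ≤ c → p ≡ 2 ^ m → n ≡ 2 * p →
  n ² ≤ 16 * V → L ≤ 16 * D → c * (k * w) ≤ n * L →
  E ≤ p * (k * (2 * w)) →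
  3 ^ k * (suc D * V) ≤ 3 ^ D * P + 3 ^ k * E →
  P ² ≤ k ² * (18 ^ m * ((2 * w) ² * (2 * w))) →
  9 * (c * c) * k ≤ 9 ^ D * (L * L * L)
kkl-arithmetic {c} {m} {n} {p} {w} {L} {D} {V} {E} {P} 1024≤c p≡ n≡2p n²≤ L≤ kw≤ E≤ low P²≤ = result
  where
  open ≤-Reasoning
  k = suc m
  instance
    c≢0 : NonZero c
    c≢0 = >-nonZero (≤-trans (s≤s z≤n) 1024≤c)
    p≢0 : NonZero p
    p≢0 = subst NonZero (sym p≡) (m^n≢0 2 m)
    n≢0 : NonZero n
    n≢0 = subst NonZero (sym n≡2p) (m*n≢0 2 p)
  E≤VD : E ≤ V * D
  E≤VD = *-cancelˡ-≤ c (begin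
    c * E                       ≤⟨ *-monoʳ-≤ c E≤ ⟩
    c * (p * (k * (2 * w)))     ≡⟨ e₁ c p k w ⟩
    2 * p * (c * (k * w))       ≡⟨ cong (_* (c * (k * w))) n≡2p ⟨
    n * (c * (k * w))           ≤⟨ *-monoʳ-≤ n kw≤ ⟩
    n * (n * L)                    ≡⟨ *-assoc n n L ⟨
    n ² * L                        ≤⟨ *-mono-≤ n²≤ L≤ ⟩
    16 * V * (16 * D)              ≡⟨ e₂ V D ⟩
    -- One factor 16 of 256 comes from the variance bound, the other from L ≤ 16D.
    256 * (V * D)                  ≤⟨ *-monoˡ-≤ (V * D) (≤-trans (m≤m+n 256 768) 1024≤c) ⟩
    c * (V * D)                 ∎)
    where
    e₁ : ∀ c p k w → c * (p * (k * (2 * w))) ≡ 2 * p * (c * (k * w))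
    e₁ = solve-∀
    e₂ : ∀ V D → 16 * V * (16 * D) ≡ 256 * (V * D)
    e₂ = solve-∀
  3^kV≤ : 3 ^ k * V ≤ 3 ^ D * P
  3^kV≤ = +-cancelʳ-≤ (3 ^ k * (V * D)) _ _ (begin
    3 ^ k * V + 3 ^ k * (V * D)    ≡⟨ e₁ (3 ^ k) V D ⟩
    3 ^ k * (suc D * V)            ≤⟨ low ⟩
    3 ^ D * P + 3 ^ k * E          ≤⟨ +-monoʳ-≤ (3 ^ D * P) (*-monoʳ-≤ (3 ^ k) E≤VD) ⟩
    3 ^ D * P + 3 ^ k * (V * D)    ∎)
    where
    e₁ : ∀ a V D → a * V + a * (V * D) ≡ a * ((1 + D) * V)
    e₁ = solve-∀
  3^² : ∀ d → 3 ^ d * 3 ^ d ≡ 9 ^ d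
  3^² d = sym (^-distribʳ-* d 3 3)
  9V²≤ : 9 * V ² ≤ 9 ^ D * (k ² * (p * ((2 * w) ² * (2 * w))))
  -- The 9ᵐ inside 18ᵐ cancels against 9ᵏ, where k = m + 1; hence the factor 9 left over.
  9V²≤ = *-cancelˡ-≤ (9 ^ m) {{m^n≢0 9 m}} (begin
    9 ^ m * (9 * V ²)              ≡⟨ e₁ (9 ^ m) V ⟩
    9 ^ k * V ²                    ≡⟨ cong (_* V ²) (3^² k) ⟨
    3 ^ k * 3 ^ k * V ²            ≡⟨ e₂ (3 ^ k) V ⟨
    (3 ^ k * V) ²                  ≤⟨ ²-mono-≤ 3^kV≤ ⟩
    (3 ^ D * P) ²                  ≡⟨ e₂ (3 ^ D) P ⟩
    3 ^ D * 3 ^ D * P ²            ≡⟨ cong (_* P ²) (3^² D) ⟩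
    9 ^ D * P ²                    ≤⟨ *-monoʳ-≤ (9 ^ D) P²≤ ⟩
    9 ^ D * (k ² * (18 ^ m * q))   ≡⟨ cong (λ s → 9 ^ D * (k ² * (s * q))) (^-distribʳ-* m 9 2) ⟩
    9 ^ D * (k ² * (9 ^ m * 2 ^ m * q))
                                   ≡⟨ cong (λ s → 9 ^ D * (k ² * (9 ^ m * s * q))) p≡ ⟨
    9 ^ D * (k ² * (9 ^ m * p * q))
                                   ≡⟨ e₃ (9 ^ D) (k ²) (9 ^ m) p q ⟩
    9 ^ m * (9 ^ D * (k ² * (p * q))) ∎)
    where
    q = (2 * w) ² * (2 * w)
    e₁ : ∀ a V → a * (9 * (V * V)) ≡ 9 * a * (V * V)
    e₁ = solve-∀
    e₂ : ∀ a V → (a * V) * (a * V) ≡ a * a * (V * V)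
    e₂ = solve-∀
    e₃ : ∀ a b c d e → a * (b * (c * d * e)) ≡ c * (a * (b * (d * e)))
    e₃ = solve-∀
  result : 9 * (c * c) * k ≤ 9 ^ D * (L * L * L)
  result = *-cancelˡ-≤ c (*-cancelˡ-≤ (n ² ²) {{m*n≢0 (n ²) (n ²) {{m*n≢0 n n}} {{m*n≢0 n n}}}} (begin
    n ² ² * (c * (9 * (c * c) * k))
      ≤⟨ *-monoˡ-≤ _ (²-mono-≤ n²≤) ⟩
    (16 * V) ² * (c * (9 * (c * c) * k))
      ≡⟨ e₁ c V k ⟩
    c * (c * c) * 256 * k * (9 * V ²)
      ≤⟨ *-monoʳ-≤ (c * (c * c) * 256 * k) 9V²≤ ⟩
    c * (c * c) * 256 * k * (9 ^ D * (k ² * (p * ((2 * w) ² * (2 * w)))))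
      ≡⟨ e₂ c (9 ^ D) k p w ⟩
    1024 * (9 ^ D * (2 * p) * ((c * (k * w)) ² * (c * (k * w))))
      -- The constant is 16² from the squared variance bound times 8 from (2w)³, with one factor 2
      -- used to turn p into n.
      ≤⟨ *-monoˡ-≤ _ 1024≤c ⟩
    c * (9 ^ D * (2 * p) * ((c * (k * w)) ² * (c * (k * w))))
      ≡⟨ cong (λ n → c * (9 ^ D * n * ((c * (k * w)) ² * (c * (k * w))))) n≡2p ⟨
    c * (9 ^ D * n * ((c * (k * w)) ² * (c * (k * w))))
      ≤⟨ *-monoʳ-≤ c (*-monoʳ-≤ (9 ^ D * n) (*-mono-≤ (²-mono-≤ kw≤) kw≤)) ⟩
    c * (9 ^ D * n * ((n * L) ² * (n * L)))
      ≡⟨ e₃ c (9 ^ D) n L ⟩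
    n ² ² * (c * (9 ^ D * (L * L * L))) ∎))
    where
    e₁ : ∀ c V k → (16 * V) * (16 * V) * (c * (9 * (c * c) * k)) ≡ c * (c * c) * 256 * k * (9 * (V * V))
    e₁ = solve-∀
    e₂ : ∀ c a k p w → c * (c * c) * 256 * k * (a * (k * k * (p * ((2 * w) * (2 * w) * (2 * w)))))
       ≡ 1024 * (a * (2 * p) * ((c * (k * w)) * (c * (k * w)) * (c * (k * w))))
    e₂ = solve-∀
    e₃ : ∀ c a n L → c * (a * n * ((n * L) * (n * L) * (n * L))) ≡ (n * n) * (n * n) * (c * (a * (L * L * L)))
    e₃ = solve-∀

-- The Kahn-Kalai-Linial theorem.  D ≈ log k / 16 dominates energy / variance, while
-- 9ᴰ is still a small power of k.
kkl : ∀ {m t w} e → 10 ≤ e → (X : Point (suc m) → Bool) → 2 ^ suc m ≡ 4 * t →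
  t < ∑ (𝟙 ∘ X) → ∑ (𝟙 ∘ X) ≤ 2 * t + 1 → (∀ i → influence X i ≤ 2 * w) →
  2 ^ suc m * ⌈log₂ suc m ⌉ ≤ 2 ^ e * (suc m * w)
kkl {m} {t} {w} e 10≤e X n≡4t t<s s≤2t+1 influence≤ = ≮⇒≥ λ kw< →
  <⇒≱ (poly-log e k D 10≤e (s≤s z≤n) (s≤s z≤n) L≤16D 16D≤L+16)
      (kkl-arithmetic {2 ^ e} {m} {2 ^ suc m} {2 ^ m} {w} {L} {D} {V} (^-monoʳ-≤ 2 10≤e) refl refl n²≤16V L≤16D (<⇒≤ kw<)
        (energy-≤ X influence≤) (noise-vs-energy D (indicator X)) (noise-≤ X influence≤))
  where
  open ≤-Reasoning
  k L D V : ℕ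
  k = suc m
  L = ⌈log₂ k ⌉
  -- The successor gives both L ≤ 16D and D ≥ 1.
  D = suc (L / 16)
  V = spectral level₊ (indicator X)
  L≤16D : L ≤ 16 * D
  L≤16D = begin
    L                       ≡⟨ m≡m%n+[m/n]*n L 16 ⟩
    L % 16 + L / 16 * 16    ≤⟨ +-monoˡ-≤ (L / 16 * 16) (<⇒≤ (m%n<n L 16)) ⟩
    16 + L / 16 * 16        ≡⟨ *-comm D 16 ⟩
    16 * D                  ∎
  16D≤L+16 : 16 * D ≤ L + 16
  16D≤L+16 = begin
    16 * D                  ≡⟨ *-comm 16 D ⟩
    16 + L / 16 * 16        ≤⟨ +-monoʳ-≤ 16 (m/n*n≤m L 16) ⟩
    16 + L                  ≡⟨ +-comm 16 L ⟩
    L + 16                  ∎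
  1≤t : 1 ≤ t
  1≤t = positive t n≡4t
    where
    positive : ∀ t → 2 ^ suc m ≡ 4 * t → 1 ≤ t
    positive zero    eq = contradiction (m^n≡0⇒m≡0 2 (suc m) eq) λ ()
    positive (suc t) _  = s≤s z≤n
  eq : ∀ t → (4 * t) * (4 * t) ≡ 16 * (t * t)
  eq = solve-∀
  n²≤16V : (2 ^ suc m) ² ≤ 16 * V
  n²≤16V = begin
    (2 ^ suc m) ²           ≡⟨ cong _² n≡4t ⟩
    (4 * t) ²               ≡⟨ eq t ⟩
    16 * t ²                ≤⟨ *-monoʳ-≤ 16 (variance-≥ X n≡4t 1≤t t<s s≤2t+1) ⟩
    16 * V                  ∎

-- Cut-rank

⨁-false : ∀ {n} (t : Fin n → Bool) → (∀ i → t i ≡ false) → ⨁ t ≡ false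
⨁-false {zero}  t t≡0 = refl
⨁-false {suc n} t t≡0 = cong₂ _xor_ (t≡0 zero) (⨁-false (t ∘ suc) (t≡0 ∘ suc))

⨁-single : ∀ {n} (t : Fin n → Bool) i → t i ≡ true → (∀ j → t j ≡ true → j ≡ i) → ⨁ t ≡ true
⨁-single t zero ti≡1 unique = cong₂ _xor_ ti≡1 (⨁-false (t ∘ suc) λ j → others j (t (suc j)) refl)
  where
  others : ∀ j b → t (suc j) ≡ b → t (suc j) ≡ false
  others j false eq = eq
  others j true  eq = contradiction (unique (suc j) eq) λ ()
⨁-single t (suc i) ti≡1 unique = cong₂ _xor_ (head (t zero) refl)
  (⨁-single (t ∘ suc) i ti≡1 λ j eq → Fin.suc-injective (unique (suc j) eq))
  where
  head : ∀ b → t zero ≡ b → t zero ≡ false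
  head false eq = eq
  head true  eq = contradiction (unique zero eq) λ ()

∈-subsets : ∀ {n} (S : Subset n) → S ∈ˡ subsets n
∈-subsets []            = here refl
∈-subsets (outside ∷ S) = ∈-++⁺ˡ (∈-map⁺ (outside ∷_) (∈-subsets S))
∈-subsets {suc n} (inside ∷ S) =
  ∈-++⁺ʳ (List.map (outside ∷_) (subsets n)) (∈-map⁺ (inside ∷_) (∈-subsets S))

rank-≥ : ∀ {m n} (M : Matrix m n) {X S : Subset m} {Y : Subset n} →
         S ⊆ X → ¬ Dependent M S Y → ∣ S ∣ ≤ rank M X Y
rank-≥ {m} M {X} {S} {Y} S⊆X indep =
  All.lookup (Extrema.xs≤max ≤-totalOrder 0 _)
    (∈-map⁺ ∣_∣ (∈-filter⁺ (λ S → (S ⊆? X) ×-dec ¬? (dependent? M S Y)) (∈-subsets S) (S⊆X , indep)))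

∣p∣≡sum : ∀ {n} (p : Subset n) → ∣ p ∣ ≡ sum (𝟙 ∘ lookup p)
∣p∣≡sum []            = refl
∣p∣≡sum (inside ∷ p)  = cong suc (∣p∣≡sum p)
∣p∣≡sum (outside ∷ p) = ∣p∣≡sum p

sum-split : ∀ m {n} (t : Fin (m + n) → ℕ) → sum t ≡ sum (t ∘ (_↑ˡ n)) + sum (t ∘ (m ↑ʳ_))
sum-split zero    t = refl
sum-split (suc m) t = trans (+-congˡ (t zero) (sum-split m (t ∘ suc))) (sym (+-assoc (t zero) _ _))

-- Points of the cube as vertices of the hypercube

bit : Bool → Fin 2
bit false = 0F
bit true  = 1F

unbit : Fin 2 → Bool
unbit 0F = false
unbit 1F = true

unbit-bit : ∀ b → unbit (bit b) ≡ b
unbit-bit false = refl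
unbit-bit true  = refl

bit-unbit : ∀ i → bit (unbit i) ≡ i
bit-unbit 0F = refl
bit-unbit 1F = refl

vertex : ∀ {k} → Point k → Fin (2 ^ k)
vertex x = funToFin (bit ∘ lookup x)

point : ∀ k → Fin (2 ^ k) → Point k
point k v = tabulate (unbit ∘ finToFun {2} {k} v)

funToFin-cong : ∀ {m n} {f g : Fin m → Fin n} → f ≗ g → funToFin f ≡ funToFin g
funToFin-cong {zero}  f≗g = refl
funToFin-cong {suc m} f≗g = cong₂ combine (f≗g zero) (funToFin-cong (f≗g ∘ suc))

point-vertex : ∀ {k} (x : Point k) → point k (vertex x) ≡ x
point-vertex x = trans
  (tabulate-cong λ i → trans (cong unbit (Fin.finToFun-funToFin (bit ∘ lookup x) i)) (unbit-bit (lookup x i)))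
  (tabulate∘lookup x)

vertex-point : ∀ k (v : Fin (2 ^ k)) → vertex (point k v) ≡ v
vertex-point k v = trans
  (funToFin-cong λ i → trans (cong bit (lookup∘tabulate (unbit ∘ finToFun {2} {k} v) i)) (bit-unbit (finToFun {2} {k} v i)))
  (Fin.funToFin-finToFin {k} {2} v)

point-injective : ∀ k {u v : Fin (2 ^ k)} → point k u ≡ point k v → u ≡ v
point-injective k {u} {v} eq =
  trans (sym (vertex-point k u)) (trans (cong vertex eq) (vertex-point k v))

-- `funToFin` makes coordinate zero the most significant digit, so the two halves of
-- `Fin (2 ^ suc k)` are the faces of that coordinate. The `+ 0` is what `2 * 2 ^ k` unfolds to.
sum≡∑ : ∀ k (t : Fin (2 ^ k) → ℕ) → sum t ≡ ∑ (t ∘ vertex {k})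
sum≡∑ zero    t = +-identityʳ _
sum≡∑ (suc k) t = begin
  sum t
    ≡⟨ sum-split (2 ^ k) t ⟩
  sum low + sum (λ v → t (2 ^ k ↑ʳ v))
    ≡⟨ +-congˡ (sum low) (trans (sum-split (2 ^ k) (λ v → t (2 ^ k ↑ʳ v))) (+-identityʳ (sum high))) ⟩
  sum low + sum high
    ≡⟨ cong₂ _+_ (sum≡∑ k low) (sum≡∑ k high) ⟩
  ∑ (t ∘ vertex {suc k}) ∎
  where
  open ≡-Reasoning
  low high : Fin (2 ^ k) → ℕ
  low  v = t (v ↑ˡ (2 ^ k + 0))
  high v = t (2 ^ k ↑ʳ (v ↑ˡ 0))

∣p∣≡∑ : ∀ k (p : Subset (2 ^ k)) → ∣ p ∣ ≡ ∑ {k} (λ x → 𝟙 (lookup p (vertex x)))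
∣p∣≡∑ k p = trans (∣p∣≡sum p) (sum≡∑ k (𝟙 ∘ lookup p))

flip : ∀ {k} → Fin k → Point k → Point k
flip i x = updateAt x i not

distance : ∀ {k} → Point k → Point k → ℕ
distance x y = ∣ zipWith _xor_ x y ∣

distance-self : ∀ {k} (x : Point k) → distance x x ≡ 0
distance-self []          = refl
distance-self (false ∷ x) = distance-self x
distance-self (true ∷ x)  = distance-self x

distance≡0⇒≡ : ∀ {k} (x y : Point k) → distance x y ≡ 0 → x ≡ y
distance≡0⇒≡ []          []          _  = refl
distance≡0⇒≡ (false ∷ x) (false ∷ y) eq = cong (false ∷_) (distance≡0⇒≡ x y eq)
distance≡0⇒≡ (true ∷ x)  (true ∷ y)  eq = cong (true ∷_) (distance≡0⇒≡ x y eq)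

distance-flip : ∀ {k} i (x : Point k) → distance x (flip i x) ≡ 1
distance-flip zero    (false ∷ x) = cong suc (distance-self x)
distance-flip zero    (true ∷ x)  = cong suc (distance-self x)
distance-flip (suc i) (false ∷ x) = distance-flip i x
distance-flip (suc i) (true ∷ x)  = distance-flip i x

distance≡1⇒flip : ∀ {k} i (x y : Point k) →
  lookup x i ≢ lookup y i → distance x y ≡ 1 → flip i x ≡ y
distance≡1⇒flip zero    (false ∷ x) (false ∷ y) x≢y _  = contradiction refl x≢y
distance≡1⇒flip zero    (true ∷ x)  (true ∷ y)  x≢y _  = contradiction refl x≢y
distance≡1⇒flip zero    (false ∷ x) (true ∷ y)  _   eq = cong (true ∷_) (distance≡0⇒≡ x y (suc-injective eq))
distance≡1⇒flip zero    (true ∷ x)  (false ∷ y) _   eq = cong (false ∷_) (distance≡0⇒≡ x y (suc-injective eq))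
distance≡1⇒flip (suc i) (false ∷ x) (false ∷ y) x≢y eq = cong (false ∷_) (distance≡1⇒flip i x y x≢y eq)
distance≡1⇒flip (suc i) (true ∷ x)  (true ∷ y)  x≢y eq = cong (true ∷_) (distance≡1⇒flip i x y x≢y eq)
distance≡1⇒flip (suc i) (false ∷ x) (true ∷ y)  x≢y eq =
  contradiction (cong (λ z → lookup z i) (distance≡0⇒≡ x y (suc-injective eq))) x≢y
distance≡1⇒flip (suc i) (true ∷ x)  (false ∷ y) x≢y eq =
  contradiction (cong (λ z → lookup z i) (distance≡0⇒≡ x y (suc-injective eq))) x≢y

flip-involutive : ∀ {k} i (x : Point k) → flip i (flip i x) ≡ x
flip-involutive zero    (b ∷ x) = cong (_∷ x) (not-involutive b)
flip-involutive (suc i) (b ∷ x) = cong (b ∷_) (flip-involutive i x)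

lookup-flip : ∀ {k} i (x : Point k) → lookup (flip i x) i ≡ not (lookup x i)
lookup-flip zero    (b ∷ x) = refl
lookup-flip (suc i) (b ∷ x) = lookup-flip i x

flip-insertAt : ∀ {k} i (x : Point k) b → flip i (insertAt x i b) ≡ insertAt x i (not b)
flip-insertAt zero    x       b = refl
flip-insertAt (suc i) (c ∷ x) b = cong (c ∷_) (flip-insertAt i x b)

adj-point : ∀ k (u v : Fin (2 ^ k)) →
  Graph.adj (hypercube k) u v ≡ (distance (point k u) (point k v) ≡ᵇ 1)
adj-point k u v = cong (λ D → ∣ D ∣ ≡ᵇ 1) (differ≡ (finToFun {2} {k} u) (finToFun {2} {k} v))
  where
  bits : ∀ a b → not (does (a Fin.≟ b)) ≡ unbit a xor unbit b
  bits 0F 0F = refl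
  bits 0F 1F = refl
  bits 1F 0F = refl
  bits 1F 1F = refl
  differ≡ : ∀ {k} (f g : Fin k → Fin 2) →
    tabulate (λ i → not (does (f i Fin.≟ g i)))
      ≡ zipWith _xor_ (tabulate (unbit ∘ f)) (tabulate (unbit ∘ g))
  differ≡ {zero}  f g = refl
  differ≡ {suc k} f g = cong₂ _∷_ (bits (f zero) (g zero)) (differ≡ (f ∘ suc) (g ∘ suc))

exits : ∀ {k} → (Point k → Bool) → Fin k → Bool → Point k → Bool
exits X i b x = X x ∧ (does (lookup x i ≟ᵇ b) ∧ not (X (flip i x)))

exits⁻ : ∀ {k} (X : Point k → Bool) i b x → exits X i b x ≡ true →
         X x ≡ true × lookup x i ≡ b × X (flip i x) ≡ false
exits⁻ X i b x eq with X x | lookup x i ≟ᵇ b | X (flip i x)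
exits⁻ X i b x eq | true | yes xᵢ≡b | false = refl , xᵢ≡b , refl

false≢true : false ≢ true
false≢true ()

≡ᵇ1⁻ : ∀ n → (n ≡ᵇ 1) ≡ true → n ≡ 1
≡ᵇ1⁻ (suc zero) _ = refl

-- Distinct points on the same side xᵢ = b are never adjacent to each other's neighbours
-- across direction i, so the edges counted by exits form an induced matching.
exits-≤-cutRank : ∀ {k} (X : Subset (2 ^ k)) i b →
  ∑ (𝟙 ∘ exits (lookup X ∘ vertex) i b) ≤ cutRank (hypercube k) X
exits-≤-cutRank {k} X i b = ≤-trans (≤-reflexive (sym size)) (rank-≥ M S⊆X independent)
  where
  M : Matrix (2 ^ k) (2 ^ k)
  M = Graph.adj (hypercube k)
  X′ : Point k → Bool
  X′ = lookup X ∘ vertex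
  S : Subset (2 ^ k)
  S = tabulate (exits X′ i b ∘ point k)
  size : ∣ S ∣ ≡ ∑ (𝟙 ∘ exits X′ i b)
  size = trans (∣p∣≡∑ k S) (∑-cong {k} λ x → cong 𝟙
    (trans (lookup∘tabulate (exits X′ i b ∘ point k) (vertex x)) (cong (exits X′ i b) (point-vertex x))))
  S⁻ : ∀ {v} → v ∈ S → X′ (point k v) ≡ true × lookup (point k v) i ≡ b × X′ (flip i (point k v)) ≡ false
  S⁻ {v} v∈S = exits⁻ X′ i b (point k v) (trans (sym (lookup∘tabulate (exits X′ i b ∘ point k) v)) ([]=⇒lookup v∈S))
  S⊆X : S ⊆ X
  S⊆X {v} v∈S = lookup⇒[]= v X (trans (cong (lookup X) (sym (vertex-point k v))) (proj₁ (S⁻ v∈S)))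
  independent : ¬ Dependent M S (∁ X)
  independent (R , R⊆S , (v , v∈R) , rowSum≡0) = contradiction
    (trans (sym (rowSum≡0 w w∈∁X)) (⨁-single (λ u → lookup R u ∧ M u w) v entry unique)) false≢true
    where
    -- The relation is tested at the column of the partner of v across direction i, where v is the
    -- only row of R with an entry.
    y : Point k
    y = flip i (point k v)
    w : Fin (2 ^ k)
    w = vertex y
    v∈S = S⁻ (R⊆S v∈R)
    w∈∁X : w ∈ ∁ X
    w∈∁X = x∉p⇒x∈∁p λ w∈X → false≢true (trans (sym (proj₂ (proj₂ v∈S))) ([]=⇒lookup w∈X))
    adj-w : ∀ u → M u w ≡ (distance (point k u) y ≡ᵇ 1)
    adj-w u = trans (adj-point k u w) (cong (λ z → distance (point k u) z ≡ᵇ 1) (point-vertex y))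
    entry : lookup R v ∧ M v w ≡ true
    entry = cong₂ _∧_ ([]=⇒lookup v∈R)
      (trans (adj-w v) (cong (_≡ᵇ 1) (distance-flip i (point k v))))
    unique : ∀ u → lookup R u ∧ M u w ≡ true → u ≡ v
    unique u eq with lookup R u in u∈R | M u w in u~w
    -- Row u lies on the side b and y on the other, so an edge between them must run in direction i.
    ... | true | true = point-injective k (begin
      point k u                ≡⟨ flip-involutive i (point k u) ⟨
      flip i (flip i (point k u)) ≡⟨ cong (flip i) (distance≡1⇒flip i (point k u) y u≢y
                                     (≡ᵇ1⁻ _ (trans (sym (adj-w u)) u~w))) ⟩
      flip i y                 ≡⟨ flip-involutive i (point k v) ⟩
      point k v                ∎)
      where
      open ≡-Reasoning
      uᵢ≡vᵢ : lookup (point k u) i ≡ lookup (point k v) i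
      uᵢ≡vᵢ = trans (proj₁ (proj₂ (S⁻ (R⊆S (lookup⇒[]= u R u∈R))))) (sym (proj₁ (proj₂ v∈S)))
      u≢y : lookup (point k u) i ≢ lookup y i
      u≢y eq = not-¬ refl (trans (sym uᵢ≡vᵢ) (trans eq (lookup-flip i (point k v))))

∑-insertAt : ∀ {k} i (f : Point (suc k) → ℕ) →
  ∑ f ≡ ∑ (λ x → f (insertAt x i false)) + ∑ (λ x → f (insertAt x i true))
∑-insertAt zero f = refl
∑-insertAt {suc k} (suc i) f = trans
  (cong₂ _+_ (∑-insertAt i (f ∘ (false ∷_))) (∑-insertAt i (f ∘ (true ∷_))))
  (+-interchange (∑ (λ x → f (false ∷ insertAt x i false))) _ _ _)

exits-insertAt : ∀ {k} (X : Point (suc k) → Bool) i b x →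
  exits X i b (insertAt x i b) ≡ X (insertAt x i b) ∧ not (X (insertAt x i (not b)))
exits-insertAt X i b x rewrite insertAt-lookup x i b | flip-insertAt i x b with b ≟ᵇ b
... | yes _  = refl
... | no b≢b = contradiction refl b≢b

influence-≤ : ∀ {m} (X : Subset (2 ^ suc m)) i →
  influence (lookup X ∘ vertex) i ≤ 2 * cutRank (hypercube (suc m)) X
influence-≤ {m} X i = begin
  ∑ (λ x → ℤ.∣ ∂ i (indicator X′) x ∣)
    ≡⟨ ∑-cong (λ x → split (X′ (insertAt x i false)) (X′ (insertAt x i true))) ⟩
  ∑ (λ x → 𝟙 (X′ (insertAt x i false) ∧ not (X′ (insertAt x i true)))
         + 𝟙 (X′ (insertAt x i true) ∧ not (X′ (insertAt x i false))))
    ≡⟨ ∑-cong (λ x → cong₂ (λ a b → 𝟙 a + 𝟙 b)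
         (exits-insertAt X′ i false x) (exits-insertAt X′ i true x)) ⟨
  ∑ (λ x → 𝟙 (exits X′ i false (insertAt x i false)) + 𝟙 (exits X′ i true (insertAt x i true)))
    ≡⟨ ∑-distrib-+ {m} _ _ ⟩
  ∑ (λ x → 𝟙 (exits X′ i false (insertAt x i false))) + ∑ (λ x → 𝟙 (exits X′ i true (insertAt x i true)))
    -- `∑-insertAt` splits a full sum over the two faces in direction i; the face in question is one
    -- of the two summands.
    ≤⟨ +-mono-≤
         (≤-trans (m≤m+n (∑ (λ x → 𝟙 (exits X′ i false (insertAt x i false)))) _)
           (≤-reflexive (sym (∑-insertAt i (𝟙 ∘ exits X′ i false)))))
         (≤-trans (m≤n+m (∑ (λ x → 𝟙 (exits X′ i true (insertAt x i true)))) _)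
           (≤-reflexive (sym (∑-insertAt i (𝟙 ∘ exits X′ i true))))) ⟩
  ∑ (𝟙 ∘ exits X′ i false) + ∑ (𝟙 ∘ exits X′ i true)
    ≤⟨ +-mono-≤ (exits-≤-cutRank {suc m} X i false) (exits-≤-cutRank {suc m} X i true) ⟩
  r + r
    ≡⟨ +-congˡ r (+-identityʳ r) ⟨
  2 * r ∎
  where
  open ≤-Reasoning
  X′ : Point (suc m) → Bool
  X′ = lookup X ∘ vertex
  r = cutRank (hypercube (suc m)) X
  split : ∀ a b → ℤ.∣ + 𝟙 a ℤ.- + 𝟙 b ∣ ≡ 𝟙 (a ∧ not b) + 𝟙 (b ∧ not a)
  split false false = refl
  split false true  = refl
  split true  false = refl
  split true  true  = refl

-- Trees

∣p∪q∣≤∣p∣+∣q∣ : ∀ {n} (p q : Subset n) → ∣ p ∪ q ∣ ≤ ∣ p ∣ + ∣ q ∣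
∣p∪q∣≤∣p∣+∣q∣ []            []            = z≤n
∣p∪q∣≤∣p∣+∣q∣ (outside ∷ p) (outside ∷ q) = ∣p∪q∣≤∣p∣+∣q∣ p q
∣p∪q∣≤∣p∣+∣q∣ (inside ∷ p)  (outside ∷ q) = s≤s (∣p∪q∣≤∣p∣+∣q∣ p q)
∣p∪q∣≤∣p∣+∣q∣ (outside ∷ p) (inside ∷ q)  =
  ≤-trans (s≤s (∣p∪q∣≤∣p∣+∣q∣ p q)) (≤-reflexive (sym (+-suc ∣ p ∣ ∣ q ∣)))
∣p∪q∣≤∣p∣+∣q∣ (inside ∷ p)  (inside ∷ q)  =
  s≤s (≤-trans (m≤n⇒m≤1+n (∣p∪q∣≤∣p∣+∣q∣ p q)) (≤-reflexive (sym (+-suc ∣ p ∣ ∣ q ∣))))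

⊆-⊎⇒∣p∣≤∣q∣+∣r∣ : ∀ {n} {p : Subset n} q r → (∀ {x} → x ∈ p → x ∈ q ⊎ x ∈ r) → ∣ p ∣ ≤ ∣ q ∣ + ∣ r ∣
⊆-⊎⇒∣p∣≤∣q∣+∣r∣ q r p⊆q⊎r =
  ≤-trans (p⊆q⇒∣p∣≤∣q∣ (x∈p∪q⁺ ∘ p⊆q⊎r)) (∣p∪q∣≤∣p∣+∣q∣ q r)

∣p∣≤∣p∩∁q∣+∣q∣ : ∀ {n} (p q : Subset n) → ∣ p ∣ ≤ ∣ p ∩ ∁ q ∣ + ∣ q ∣
∣p∣≤∣p∩∁q∣+∣q∣ p q = ⊆-⊎⇒∣p∣≤∣q∣+∣r∣ (p ∩ ∁ q) q split
  where
  split : ∀ {x} → x ∈ p → x ∈ p ∩ ∁ q ⊎ x ∈ q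
  split {x} x∈p with x ∈? q
  ... | yes x∈q = inj₂ x∈q
  ... | no  x∉q = inj₁ (x∈p∩q⁺ (x∈p , x∉p⇒x∈∁p x∉q))

empty⇒∣p∣≡0 : ∀ {n} (p : Subset n) → (∀ {x} → x ∉ p) → ∣ p ∣ ≡ 0
empty⇒∣p∣≡0 {n} p x∉p = trans (cong ∣_∣ (Empty-unique {p = p} λ { (_ , x∈p) → x∉p x∈p })) (∣⊥∣≡0 n)

∣p∣≡0⇒empty : ∀ {n} {p : Subset n} {x} → ∣ p ∣ ≤ 0 → x ∉ p
∣p∣≡0⇒empty ∣p∣≤0 x∈p = contradiction (≤-trans (x∈p⇒∣p-x∣<∣p∣ x∈p) ∣p∣≤0) λ ()

subsingleton⇒∣p∣≤1 : ∀ {n} (p : Subset n) → (∀ {x y} → x ∈ p → y ∈ p → x ≡ y) → ∣ p ∣ ≤ 1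
subsingleton⇒∣p∣≤1 p unique with nonempty? p
... | yes (x , x∈p) = ≤-trans
  (p⊆q⇒∣p∣≤∣q∣ λ {y} y∈p → subst (_∈ ⁅ x ⁆) (unique x∈p y∈p) (x∈⁅x⁆ x))
  (≤-reflexive (∣⁅x⁆∣≡1 x))
... | no empty = ≤-trans (≤-reflexive (empty⇒∣p∣≡0 p λ x∈p → empty (_ , x∈p))) z≤n

-- Induction on l: an index c with at most t points in `F c` is deleted from S together with those
-- points, and more than l * t points of P remain.
cover-pigeonhole : ∀ {n m} l t (S : Subset m) (F : Fin m → Subset n) (P : Subset n) →
  ∣ S ∣ ≤ l → (∀ {x} → x ∈ P → ∃[ c ] c ∈ S × x ∈ F c) → l * t < ∣ P ∣ →
  ∃[ c ] c ∈ S × t < ∣ F c ∣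
cover-pigeonhole zero t S F P ∣S∣≤0 covers 0<∣P∣ =
  contradiction (empty⇒∣p∣≡0 P λ x∈P → ∣p∣≡0⇒empty ∣S∣≤0 (proj₁ (proj₂ (covers x∈P)))) (>⇒≢ 0<∣P∣)
cover-pigeonhole (suc l) t S F P ∣S∣≤1+l covers lt with nonempty? S
... | no empty = contradiction
  (empty⇒∣p∣≡0 P λ x∈P → empty (_ , proj₁ (proj₂ (covers x∈P)))) (>⇒≢ (≤-<-trans z≤n lt))
... | yes (c , c∈S) with t <? ∣ F c ∣
...   | yes t<∣Fc∣ = c , c∈S , t<∣Fc∣
...   | no  t≮∣Fc∣ =
  let (d , d∈S-c , t<∣Fd∣) = cover-pigeonhole l t (S - c) F (P ∩ ∁ (F c))
        (s≤s⁻¹ (≤-trans (x∈p⇒∣p-x∣<∣p∣ c∈S) ∣S∣≤1+l)) covers′ lt′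
  in d , p─q⊆p S ⁅ c ⁆ d∈S-c , t<∣Fd∣
  where
  covers′ : ∀ {x} → x ∈ P ∩ ∁ (F c) → ∃[ d ] d ∈ S - c × x ∈ F d
  covers′ {x} x∈ = let (x∈P , x∈∁Fc) = x∈p∩q⁻ P (∁ (F c)) x∈
                       (d , d∈S , x∈Fd) = covers x∈P
                   in d , x∈p∧x≢y⇒x∈p-y d∈S (λ d≡c → x∈∁p⇒x∉p x∈∁Fc (subst (λ e → x ∈ F e) d≡c x∈Fd)) , x∈Fd
  lt′ : l * t < ∣ P ∩ ∁ (F c) ∣
  lt′ = +-cancelˡ-< t _ _ (≤-trans lt (≤-trans (∣p∣≤∣p∩∁q∣+∣q∣ P (F c))
    (≤-trans (+-monoʳ-≤ ∣ P ∩ ∁ (F c) ∣ (≮⇒≥ t≮∣Fc∣)) (≤-reflexive (+-comm _ t)))))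

⟦_⟧ : ∀ {n} {P : Fin n → Set} → (∀ x → Dec (P x)) → Subset n
⟦ P? ⟧ = tabulate (λ x → does (P? x))

∈⟦⟧⁺ : ∀ {n} {P : Fin n → Set} (P? : ∀ x → Dec (P x)) {x} → P x → x ∈ ⟦ P? ⟧
∈⟦⟧⁺ P? {x} px = lookup⇒[]= x _ (trans (lookup∘tabulate _ x) (dec-true (P? x) px))

∈⟦⟧⁻ : ∀ {n} {P : Fin n → Set} (P? : ∀ x → Dec (P x)) {x} → x ∈ ⟦ P? ⟧ → P x
∈⟦⟧⁻ P? {x} x∈ with P? x | trans (sym (lookup∘tabulate (λ x → does (P? x)) x)) ([]=⇒lookup x∈)
... | yes px | _ = px

-- Paths, cycles and the two sides of an edge

record SimplePath {n} (R : Fin n → Fin n → Set) (l : ℕ) (x y : Fin n) : Set where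
  field
    at        : Fin (suc l) → Fin n
    injective : Injective _≡_ _≡_ at
    start     : at zero ≡ x
    end       : at (fromℕ l) ≡ y
    step      : ∀ i → R (at (inject₁ i)) (at (suc i))

module _ {n} {R : Fin n → Fin n → Set} where

  open SimplePath

  suffix : ∀ {l x y} (p : SimplePath R l x y) i → ∃[ k ] SimplePath R k (at p i) y
  suffix {l} p zero = l , record
    { at = at p ; injective = injective p ; start = refl ; end = end p ; step = step p }
  suffix {suc l} p (suc i) = suffix (record
    { at = at p ∘ suc ; injective = Fin.suc-injective ∘ injective p
    ; start = refl ; end = end p ; step = step p ∘ suc }) i

  cons : ∀ {l x y z} → R x y → (p : SimplePath R l y z) → (∀ i → at p i ≢ x) → SimplePath R (suc l) x z
  cons {l} {x} Rxy p fresh = record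
    { at = at′ ; injective = injective′ ; start = refl ; end = end p ; step = step′ }
    where
    at′ : Fin (suc (suc l)) → Fin n
    at′ zero    = x
    at′ (suc i) = at p i
    injective′ : Injective _≡_ _≡_ at′
    injective′ {zero}  {zero}  _  = refl
    injective′ {zero}  {suc j} eq = contradiction (sym eq) (fresh j)
    injective′ {suc i} {zero}  eq = contradiction eq (fresh i)
    injective′ {suc i} {suc j} eq = cong suc (injective p eq)
    step′ : ∀ i → R (at′ (inject₁ i)) (at′ (suc i))
    step′ zero    = subst (R x) (sym (start p)) Rxy
    step′ (suc i) = step p i

  -- Loop erasure: if the new first vertex already occurs on the path, the suffix from there is
  -- kept.
  simplify : ∀ {x y} → Star R x y → ∃[ l ] SimplePath R l x y
  simplify {x} ε = 0 , record
    { at = λ _ → x ; injective = λ { {zero} {zero} _ → refl }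
    ; start = refl ; end = refl ; step = λ () }
  simplify {x} (Rxy ◅ walk) with simplify walk
  ... | l , p with Fin.any? (λ i → at p i Fin.≟ x)
  ...   | yes (i , refl) = suffix p i
  ...   | no  fresh      = suc l , cons Rxy p λ i eq → fresh (i , eq)

module _ {N} (G : Graph N) where

  open Graph G

  ~-sym : ∀ {u v} → u ~ v → v ~ u
  ~-sym {u} {v} = subst T (adj-sym u v)

  ~⇒≢ : ∀ {u v} → u ~ v → u ≢ v
  ~⇒≢ {u} u~u refl = subst T (adj-irr u) u~u

  -- A simple path of length 0 would make ab a loop, and one of length 1 would be the deleted edge;
  -- a longer one is closed by ab.
  bypass⇒cycle : ∀ {a b} → a ~ b → Star (Without a b) a b → Cycle
  bypass⇒cycle {a} {b} a~b walk with simplify walk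
  ... | 0 , p = contradiction (trans (sym (start p)) (end p)) (~⇒≢ a~b)
    where open SimplePath
  ... | 1 , p = contradiction (start p , end p) (proj₁ (proj₂ (step p zero)))
    where open SimplePath
  ... | suc (suc l) , p = record
    { vertex    = at p
    ; injective = injective p
    ; step      = proj₁ ∘ step p
    ; close     = subst₂ _~_ (sym (end p)) (sym (start p)) (~-sym a~b)
    }
    where open SimplePath

  -- A step into a or b restarts the walk at that end. A step to any other vertex is not along ab
  -- and stays on its side.
  edge-sides-cover : ∀ {a b u v} → Star (Without a b) a u ⊎ Star (Without b a) b u → Star _~_ u v →
                     Star (Without a b) a v ⊎ Star (Without b a) b v
  edge-sides-cover side ε = side
  edge-sides-cover {a} {b} {u} side (_◅_ {j = w} u~w walk) = edge-sides-cover (move side) walk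
    where
    move : Star (Without a b) a u ⊎ Star (Without b a) b u →
           Star (Without a b) a w ⊎ Star (Without b a) b w
    move side with w Fin.≟ a | w Fin.≟ b
    ... | yes refl | _        = inj₁ ε
    ... | no _     | yes refl = inj₂ ε
    ... | no w≢a   | no w≢b   with side
    ...   | inj₁ s = inj₁ (s ◅◅ (u~w , (w≢b ∘ proj₂) , (w≢a ∘ proj₂)) ◅ ε)
    ...   | inj₂ s = inj₂ (s ◅◅ (u~w , (w≢a ∘ proj₂) , (w≢b ∘ proj₂)) ◅ ε)

  -- Each departure from a opens a new branch, with c ≠ b because ab is deleted; steps between
  -- vertices other than a stay in the current branch.
  side-branches : ∀ {a b v} → Star (Without a b) a v →
                  v ≡ a ⊎ ∃[ c ] (a ~ c × c ≢ b × Star (Without c a) c v)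
  side-branches {a} {b} = go (inj₁ refl)
    where
    Branch : Fin N → Set
    Branch v = v ≡ a ⊎ ∃[ c ] (a ~ c × c ≢ b × Star (Without c a) c v)
    go : ∀ {u v} → Branch u → Star (Without a b) u v → Branch v
    go branch ε = branch
    go {u} branch (_◅_ {j = w} (u~w , ¬ab , ¬ba) walk) = go (next branch) walk
      where
      next : Branch u → Branch w
      next branch with w Fin.≟ a | u Fin.≟ a | branch
      ... | yes w≡a | _        | _         = inj₁ w≡a
      ... | no _    | yes refl | _         = inj₂ (w , u~w , (λ w≡b → ¬ab (refl , w≡b)) , ε)
      ... | no _    | no u≢a   | inj₁ u≡a  = contradiction u≡a u≢a
      ... | no w≢a  | no u≢a   | inj₂ (c , a~c , c≢b , s) =
        inj₂ (c , a~c , c≢b , s ◅◅ (u~w , (w≢a ∘ proj₂) , (u≢a ∘ proj₁)) ◅ ε)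

  module _ (acyclic : ¬ Cycle) where

    side-avoids : ∀ {a c} → a ~ c → ¬ Star (Without c a) c a
    side-avoids a~c walk = acyclic (bypass⇒cycle (~-sym a~c) walk)

    -- By acyclicity a walk inside the branch at c never returns to a, hence never uses the edge ab.
    branch⊆side : ∀ {a b c v} → a ~ b → a ~ c → c ≢ b → Star (Without c a) c v → Star (Without a b) a v
    branch⊆side {a} {b} {c} a~b a~c c≢b = go ε ((a~c , (c≢b ∘ proj₂) , (~⇒≢ a~b ∘ proj₁)) ◅ ε)
      where
      go : ∀ {u v} → Star (Without c a) c u → Star (Without a b) a u →
           Star (Without c a) u v → Star (Without a b) a v
      go _  s ε = s
      go s′ s (e ◅ walk) = go s″ (s ◅◅ (proj₁ e
          , (λ { (refl , _) → side-avoids a~c s′ })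
          , (λ { (_ , refl) → side-avoids a~c s″ })) ◅ ε) walk
        where s″ = s′ ◅◅ e ◅ ε

-- Balanced edges of a rank-decomposition

module _ {n} (D : RankDecomposition n) where

  open RankDecomposition D

  leafOf-injective : ∀ {u v} → leafOf u ≡ leafOf v → u ≡ v
  leafOf-injective eq = Bijection.injective labelling (lift eq)
    where
    lift : ∀ {x y : Leaf} → proj₁ x ≡ proj₁ y → x ≡ y
    lift {_ , p} {_ , q} refl = cong (_ ,_) (≡-irrelevant p q)

  -- Needed only under a double negation, since the final bound is decidable.
  Decidable-sides : Set
  Decidable-sides = ∀ a b v → Dec (Star (Without a b) a v)

  -- Excluded middle holds under a double negation for each triple, and double negation commutes
  -- with quantification over `Fin`.
  ¬¬decidable-sides : ¬ ¬ Decidable-sides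
  ¬¬decidable-sides = sequence λ a → sequence λ b → sequence λ v → ¬¬-excluded-middle
    where sequence = Fin.sequence (RawMonad.rawApplicative ¬¬-Monad)

  module _ (reach? : Decidable-sides) where

    nodesOf : Fin nodes → Fin nodes → Subset nodes
    nodesOf a b = ⟦ reach? a b ⟧

    side : Fin nodes → Fin nodes → Subset n
    side a b = ⟦ reach? a b ∘ leafOf ⟧

    side-isSide : ∀ a b → IsSide a b (side a b)
    side-isSide a b v = mk⇔ (∈⟦⟧⁻ (reach? a b ∘ leafOf)) (∈⟦⟧⁺ (reach? a b ∘ leafOf))

    some-edge : ∃[ a ] ∃[ b ] a ~ b
    some-edge = go nodes≥2 (proj₁ isTree)
      where
      go : 2 ≤ nodes → Connected → ∃[ a ] ∃[ b ] a ~ b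
      go (s≤s (s≤s z≤n)) connected with connected zero (suc zero)
      ... | a~b ◅ _ = _ , _ , a~b

    n≤∣side∣+∣side∣ : ∀ {a b} → n ≤ ∣ side a b ∣ + ∣ side b a ∣
    n≤∣side∣+∣side∣ {a} {b} = ≤-trans (≤-reflexive (sym (∣⊤∣≡n n)))
      (⊆-⊎⇒∣p∣≤∣q∣+∣r∣ {p = ⊤} (side a b) (side b a) λ {v} _ →
        [ inj₁ ∘ ∈⟦⟧⁺ (reach? a b ∘ leafOf) , inj₂ ∘ ∈⟦⟧⁺ (reach? b a ∘ leafOf) ]′
          (edge-sides-cover tree (inj₁ ε) (proj₁ isTree a (leafOf v))))

    -- The termination measure of `descend`. On tree nodes, rather than labels, strictness is
    -- immediate: a itself is lost.
    nodesOf-shrinks : ∀ {a b c} → a ~ b → a ~ c → c ≢ b → nodesOf c a ⊂ nodesOf a b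
    nodesOf-shrinks {a} {b} {c} a~b a~c c≢b =
        (λ v∈ → ∈⟦⟧⁺ (reach? a b) (branch⊆side tree acyclic a~b a~c c≢b (∈⟦⟧⁻ (reach? c a) v∈)))
      , a , ∈⟦⟧⁺ (reach? a b) ε , side-avoids tree acyclic a~c ∘ ∈⟦⟧⁻ (reach? c a)
      where acyclic = proj₂ isTree

    -- Besides at most one label at a itself, the side of a is covered by the branches at its at
    -- most two neighbours other than b; hence the threshold 2t + 1.
    heavy-branch : ∀ {a b t} → a ~ b → 2 * t + 1 < ∣ side a b ∣ →
                   ∃[ c ] (a ~ c × c ≢ b × t < ∣ side c a ∣)
    heavy-branch {a} {b} {t} a~b heavy =
      let (c , c∈ , t<) = cover-pigeonhole 2 t (neighbours - b) (λ c → side c a)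
                            (side a b ∩ ∁ labelOf) ∣N-b∣≤2 covers many
      in c , neighbour (p─q⊆p neighbours ⁅ b ⁆ c∈)
           , (λ c≡b → x∉p-x neighbours (subst (_∈ neighbours - b) c≡b c∈)) , t<
      where
      neighbours : Subset nodes
      neighbours = tabulate (adj a)
      neighbour : ∀ {c} → c ∈ neighbours → a ~ c
      neighbour {c} c∈ = subst T (sym (trans (sym (lookup∘tabulate (adj a) c)) ([]=⇒lookup c∈))) _
      neighbour⁻ : ∀ {c} → a ~ c → c ∈ neighbours
      neighbour⁻ {c} a~c = lookup⇒[]= c _ (trans (lookup∘tabulate (adj a) c) (T⇒≡ a~c))
        where
        T⇒≡ : ∀ {b} → T b → b ≡ true
        T⇒≡ {true} _ = refl
      x∉p-x : ∀ {m} (p : Subset m) {x} → x ∉ p - x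
      x∉p-x (_ ∷ p) {zero}  ()
      x∉p-x (_ ∷ p) {suc x} (Vec.there x∈) = x∉p-x p x∈
      degree≤3 : degree a ≤ 3
      degree≤3 = [ (λ eq → ≤-trans (≤-reflexive eq) (s≤s z≤n)) , ≤-reflexive ]′ (subcubic a)
      ∣N-b∣≤2 : ∣ neighbours - b ∣ ≤ 2
      ∣N-b∣≤2 = s≤s⁻¹ (≤-trans (x∈p⇒∣p-x∣<∣p∣ (neighbour⁻ a~b)) degree≤3)
      labelOf? : ∀ v → Dec (leafOf v ≡ a)
      labelOf? v = leafOf v Fin.≟ a
      labelOf : Subset n
      labelOf = ⟦ labelOf? ⟧
      ∣labelOf∣≤1 : ∣ labelOf ∣ ≤ 1
      ∣labelOf∣≤1 = subsingleton⇒∣p∣≤1 labelOf λ u∈ v∈ →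
        leafOf-injective (trans (∈⟦⟧⁻ labelOf? u∈) (sym (∈⟦⟧⁻ labelOf? v∈)))
      covers : ∀ {v} → v ∈ side a b ∩ ∁ labelOf → ∃[ c ] c ∈ neighbours - b × v ∈ side c a
      covers {v} v∈ with x∈p∩q⁻ (side a b) (∁ labelOf) v∈
      ... | v∈side , v∈∁labelOf with side-branches tree (∈⟦⟧⁻ (reach? a b ∘ leafOf) v∈side)
      ...   | inj₁ at-a = contradiction (∈⟦⟧⁺ labelOf? at-a) (x∈∁p⇒x∉p v∈∁labelOf)
      ...   | inj₂ (c , a~c , c≢b , s) =
        c , x∈p∧x≢y⇒x∈p-y (neighbour⁻ a~c) c≢b , ∈⟦⟧⁺ (reach? c a ∘ leafOf) s
      many : 2 * t < ∣ side a b ∩ ∁ labelOf ∣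
      many = +-cancelʳ-< 1 _ _ (<-≤-trans heavy (≤-trans (∣p∣≤∣p∩∁q∣+∣q∣ (side a b) labelOf)
        (+-monoʳ-≤ ∣ side a b ∩ ∁ labelOf ∣ ∣labelOf∣≤1)))

    Balanced : ℕ → Set
    Balanced t = ∃[ a ] ∃[ b ] (a ~ b × t < ∣ side a b ∣ × ∣ side a b ∣ ≤ 2 * t + 1)

    -- As long as the side of a is too heavy, step to a branch at a that is still heavy.
    descend : ∀ {a b t} m → ∣ nodesOf a b ∣ ≤ m → a ~ b → t < ∣ side a b ∣ → Balanced t
    descend {a} {b} zero ∣nodes∣≤0 a~b t< =
      contradiction (∈⟦⟧⁺ (reach? a b) ε) (∣p∣≡0⇒empty ∣nodes∣≤0)
    descend {a} {b} {t} (suc m) ∣nodes∣≤1+m a~b t< with ∣ side a b ∣ ≤? 2 * t + 1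
    ... | yes ≤2t+1 = a , b , a~b , t< , ≤2t+1
    ... | no  ≰2t+1 = let (c , a~c , c≢b , t<′) = heavy-branch a~b (≰⇒> ≰2t+1) in
      descend m (s≤s⁻¹ (≤-trans (p⊂q⇒∣p∣<∣q∣ (nodesOf-shrinks a~b a~c c≢b)) ∣nodes∣≤1+m))
        (~-sym tree a~c) t<′

    balanced-edge : ∀ {t} → 2 * t < n → Balanced t
    balanced-edge {t} 2t<n = let (a , b , a~b) = some-edge in choose a b a~b
      where
      choose : ∀ a b → a ~ b → Balanced t
      choose a b a~b with t <? ∣ side a b ∣ | t <? ∣ side b a ∣
      ... | yes t< | _      = descend _ ≤-refl a~b t<
      ... | no _   | yes t< = descend _ ≤-refl (~-sym tree a~b) t<
      ... | no t≮  | no t≮′ = contradiction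
        (<-≤-trans 2t<n (≤-trans n≤∣side∣+∣side∣ (≤-trans (+-mono-≤ (≮⇒≥ t≮) (≮⇒≥ t≮′))
          (≤-reflexive (cong (λ s → t + s) (sym (+-identityʳ t)))))))
        (<-irrefl refl)

-- Rank-width of the hypercube

rankWidth-≥ : ∀ e m {w} → 10 ≤ e → IsRankWidth (hypercube (suc (suc m))) w →
  2 ^ suc (suc m) * ⌈log₂ suc (suc m) ⌉ ≤ 2 ^ e * (suc (suc m) * w)
rankWidth-≥ e m {w} 10≤e ((D , (_ , cutRank≤w)) , _) =
  decidable-stable (_ ≤? _) λ ≰ → ¬¬decidable-sides D λ reach? → ≰ (bound reach?)
  where
  -- A quarter of the vertices, so the balanced side holds between a quarter and, up to one vertex,
  -- a half of the cube.
  t = 2 ^ m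
  n≡4t : 2 ^ suc (suc m) ≡ 4 * t
  n≡4t = sym (*-assoc 2 2 t)
  2t<n : 2 * t < 2 ^ suc (suc m)
  2t<n = *-monoʳ-< 2 (m<m+n t (≤-trans (m^n>0 2 m) (m≤m+n t 0)))
  bound : Decidable-sides D → 2 ^ suc (suc m) * ⌈log₂ suc (suc m) ⌉ ≤ 2 ^ e * (suc (suc m) * w)
  bound reach? with balanced-edge D reach? {t} 2t<n
  ... | a , b , a~b , t<∣X∣ , ∣X∣≤2t+1 = kkl {suc m} {t} {w} e 10≤e (lookup X ∘ vertex) n≡4t
    (<-≤-trans t<∣X∣ (≤-reflexive (∣p∣≡∑ (suc (suc m)) X)))
    (≤-trans (≤-reflexive (sym (∣p∣≡∑ (suc (suc m)) X))) ∣X∣≤2t+1)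
    λ i → ≤-trans (influence-≤ {suc m} X i)
      (*-monoʳ-≤ 2 (cutRank≤w (a , b , X , a~b , side-isSide D reach? a b , refl)))
    where X = side D reach? a b

÷₀-≤ : ∀ d a b w → a ≤ suc d * (b * w) → ℚᵘ.mkℚᵘ (+ 1) d ℚᵘ.* (a ÷₀ b) ℚᵘ.≤ + w ℚᵘ./ 1
-- Division by 0 yields 0, so the claim is 0 ≤ w.
÷₀-≤ d a zero    w _  = ℚᵘ.*≤* (ℤ.≤-trans (ℤ.+≤+ z≤n) (ℤ.≤-reflexive (ℤ.pos-* w (suc d * 1))))
÷₀-≤ d a (suc b) w a≤ = ℚᵘ.*≤* (begin
  + 1 ℤ.* + a ℤ.* + 1               ≡⟨ trans (ℤ.*-identityʳ _) (ℤ.*-identityˡ _) ⟩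
  + a                               ≤⟨ ℤ.+≤+ a≤ ⟩
  + (suc d * (suc b * w))           ≡⟨ cong +_ (lemma (suc d) (suc b) w) ⟩
  + (w * (suc d * suc b))           ≡⟨ ℤ.pos-* w (suc d * suc b) ⟩
  + w ℤ.* + (suc d * suc b)         ∎)
  where
  open ℤ.≤-Reasoning
  lemma : ∀ a b c → a * (b * c) ≡ c * (a * b)
  lemma = solve-∀

corollary23 : (rw : ℕ → ℕ) → (∀ k → 1 ≤ k → IsRankWidth (hypercube k) (rw k)) → rw ∈Ω cubeBound × rw ∈Ω (λ k → orderBound (2 ^ k))
corollary23 rw isRankWidth = (c , 0<c , 2 , cube) , (c , 0<c , 2 , order)
  where
  -- `mkℚᵘ` takes the denominator minus one, so this is 2⁻¹⁰, with the least exponent that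
  -- `rankWidth-≥` admits.
  c = ℚᵘ.mkℚᵘ (+ 1) (pred (2 ^ 10))
  0<c : ℚᵘ.0ℚᵘ ℚᵘ.< c
  0<c = ℚᵘ.*<* (ℤ.+<+ (s≤s z≤n))
  cube : ∀ k → 2 ≤ k → c ℚᵘ.* cubeBound k ℚᵘ.≤ + rw k ℚᵘ./ 1
  cube (suc (suc m)) (s≤s (s≤s z≤n)) = ÷₀-≤ (pred (2 ^ 10)) _ (suc (suc m)) (rw (suc (suc m)))
    (rankWidth-≥ 10 m ≤-refl (isRankWidth (suc (suc m)) (s≤s z≤n)))
  order : ∀ k → 2 ≤ k → c ℚᵘ.* orderBound (2 ^ k) ℚᵘ.≤ + rw k ℚᵘ./ 1
  -- At n = 2ᵏ the rounded logarithm is exactly k, so the two bounds coincide.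
  order k 2≤k = subst (λ l → c ℚᵘ.* ((2 ^ k * ⌈log₂ l ⌉) ÷₀ l) ℚᵘ.≤ + rw k ℚᵘ./ 1)
    (sym (⌈log₂2^n⌉≡n k)) (cube k 2≤k)
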